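{- Let $X=(VX,EX)$ be a graph. Then for every $r\in\mathbb N$, \[ \operatorname{sep}_X(r)-1 \leq \max\{\operatorname{tw}(\Gamma) : \Gamma\leq X,\ |V\Gamma|\leq r\} \leq 15\operatorname{sep}_X(r). \]
   Context: $\Gamma\leq X$ means $\Gamma=(V\Gamma,E\Gamma)$ is a (finite) subgraph of $X$. For a finite graph $\Gamma$, the cutsize $\operatorname{cut}(\Gamma)$ is the minimum cardinality of a subset $S\subseteq V\Gamma$ such that every connected component of $\Gamma-S$ contains at most $\frac12|V\Gamma|$ vertices. The separation profile of a graph $X$ is the function $\operatorname{sep}_X:\mathbb N\to\mathbb N$, $\operatorname{sep}_X(r)=\max\{\operatorname{cut}(\Gamma) : \Gamma\leq X,\ |V\Gamma|\leq r\}$. A tree-decomposition of a graph $\Gamma$ is a pair $(T,\{X_g\}_{g\in VT})$, where $T=(VT,ET)$ is a tree, each $X_g\subseteq V\Gamma$, and: (1) $\bigcup_{g\in VT}X_g=V\Gamma$; (2) for every edge $vw\in E\Gamma$ there is some $g\in VT$ with $v,w\in X_g$; (3) for each $v\in V\Gamma$, the full subgraph of $T$ with vertex set $\{g\in VT : v\in X_g\}$ is connected. Its width is $\max_{g\in VT}|X_g|-1$, and the treewidth $\operatorname{tw}(\Gamma)$ is the minimum width of a tree-decomposition of $\Gamma$. -}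

module Defs where

open import Data.Empty using (⊥-elim) renaming (⊥ to Empty)
open import Data.Fin as Fin using (Fin; inject₁; fromℕ)
open import Data.Fin.Subset using (Subset; _∈_; _∉_; _⊆_; ∣_∣; Nonempty; ⊤)
open import Data.Fin.Subset.Properties using (∣p∣≤n; ∣⊤∣≡n; ∈⊤)
open import Data.Integer as ℤ using (ℤ; +_; 1ℤ; +≤+)
import Data.Integer.Properties as ℤₚ
open import Data.Nat as ℕ using (ℕ)
open import Data.Nat.Induction using (<-wellFounded)
import Data.Nat.Properties as ℕₚ
open import Data.Product using (∃; ∃-syntax; _×_; _,_; proj₁)
open import Data.Unit using (tt) renaming (⊤ to Unit)
open import Function using (flip)
open import Induction.WellFounded using (Acc; acc)
open import Level using (Level; _⊔_; 0ℓ; suc)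
open import Relation.Binary using (Rel; Decidable; Symmetric)
open import Relation.Binary.Construct.Closure.ReflexiveTransitive using (Star; ε)
open import Relation.Binary.PropositionalEquality using (_≡_; refl; sym; trans; cong; subst; subst₂)
open import Relation.Nullary using (¬_; yes; no)
open import Relation.Unary using (Pred)

private
  variable
    a v e p r : Level

record Graph v e : Set (suc (v ⊔ e)) where
  field
    Vertex   : Set v
    _~_      : Rel Vertex e
    ~-sym    : Symmetric _~_
    ~-irrefl : ∀ {x} → ¬ (x ~ x)

full : (G : Graph v e) → Pred (Graph.Vertex G) p → Graph (v ⊔ p) e
full G P = record
  { Vertex   = ∃ P
  ; _~_      = λ x y → proj₁ x ~ proj₁ y
  ; ~-sym    = ~-sym
  ; ~-irrefl = ~-irrefl
  }
  where open Graph G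

-- The graph without vertices counts as connected.
Connected : Graph v e → Set (v ⊔ e)
Connected G = ∀ x y → Star _~_ x y
  where open Graph G

record Cycle (G : Graph v e) : Set (v ⊔ e) where
  open Graph G
  field
    k         : ℕ
    at        : Fin (3 ℕ.+ k) → Vertex
    injective : ∀ {i j} → at i ≡ at j → i ≡ j
    step      : ∀ i → at (inject₁ i) ~ at (Fin.suc i)
    close     : at (fromℕ (2 ℕ.+ k)) ~ at Fin.zero

record IsTree (T : Graph v e) : Set (v ⊔ e) where
  field
    node      : Graph.Vertex T
    connected : Connected T
    acyclic   : ¬ Cycle T

-- Adjacency is decidable because the edge set is finite, i.e. can be listed.
record FiniteGraph : Set₁ where
  field
    order    : ℕ
    _~_      : Rel (Fin order) 0ℓ
    _~?_     : Decidable _~_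
    ~-sym    : Symmetric _~_
    ~-irrefl : ∀ {x} → ¬ (x ~ x)

  graph : Graph 0ℓ 0ℓ
  graph = record { Vertex = Fin order ; _~_ = _~_ ; ~-sym = ~-sym ; ~-irrefl = ~-irrefl }

open FiniteGraph public using (order; graph)

-- A finite subgraph of X is given by numbering its vertices: `embed` lists
-- them without repetition, and the edges of Γ name those edges of X that are
-- kept (not necessarily all the edges of X between the listed vertices).
record _⊑_ (Γ : FiniteGraph) (X : Graph v e) : Set (v ⊔ e) where
  open FiniteGraph Γ using (_~_)
  field
    embed     : Fin (order Γ) → Graph.Vertex X
    injective : ∀ {x y} → embed x ≡ embed y → x ≡ y
    edge      : ∀ {x y} → x ~ y → Graph._~_ X (embed x) (embed y)

infix 4 _⊑_

-- These are relations, not functions: a maximum over all finite subgraphs of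
-- an arbitrary X is not computable.  See `sep-exists` and `maxTw-exists`.

IsMax : {A : Set a} → Rel A r → Pred A p → A → Set (a ⊔ r ⊔ p)
IsMax _≤_ P m = P m × (∀ {k} → P k → k ≤ m)

IsMin : {A : Set a} → Rel A r → Pred A p → A → Set (a ⊔ r ⊔ p)
IsMin _≤_ P m = P m × (∀ {k} → P k → m ≤ k)

-- C is the vertex set of a connected component of Γ − S.
record IsComponent (Γ : FiniteGraph) (S C : Subset (order Γ)) : Set where
  field
    nonempty  : Nonempty C
    avoids    : ∀ {x} → x ∈ C → x ∉ S
    connected : Connected (full (graph Γ) (_∈ C))
    maximal   : ∀ D → C ⊆ D → (∀ {x} → x ∈ D → x ∉ S) →
                Connected (full (graph Γ) (_∈ D)) → D ⊆ C

IsCutset : (Γ : FiniteGraph) → Subset (order Γ) → Set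
IsCutset Γ S = ∀ C → IsComponent Γ S C → 2 ℕ.* ∣ C ∣ ℕ.≤ order Γ

IsCut : FiniteGraph → ℕ → Set
IsCut Γ = IsMin ℕ._≤_ λ k → ∃[ S ] IsCutset Γ S × k ≡ ∣ S ∣

IsSep : Graph v e → ℕ → ℕ → Set (suc 0ℓ ⊔ v ⊔ e)
IsSep X r = IsMax ℕ._≤_ λ k → ∃[ Γ ] Γ ⊑ X × order Γ ℕ.≤ r × IsCut Γ k

-- The tree may be infinite.
record TreeDecomposition (Γ : FiniteGraph) : Set₁ where
  open FiniteGraph Γ using (_~_)
  field
    tree   : Graph 0ℓ 0ℓ
    isTree : IsTree tree

  open Graph tree public using () renaming (Vertex to Node)

  field
    bag       : Node → Subset (order Γ)
    vertices  : ∀ x → ∃[ g ] x ∈ bag g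
    edges     : ∀ {x y} → x ~ y → ∃[ g ] x ∈ bag g × y ∈ bag g
    connected : ∀ x → Connected (full tree λ g → x ∈ bag g)

open TreeDecomposition using (Node; bag)

-- Integer-valued, so that the graph without vertices has treewidth -1.
IsWidth : ∀ {Γ} → TreeDecomposition Γ → ℤ → Set
IsWidth D = IsMax ℤ._≤_ λ k → ∃[ g ] k ≡ + ∣ bag D g ∣ ℤ.- 1ℤ

IsTw : FiniteGraph → ℤ → Set₁
IsTw Γ = IsMin ℤ._≤_ λ k → ∃[ D ] IsWidth {Γ} D k

IsMaxTw : Graph v e → ℕ → ℤ → Set (suc 0ℓ ⊔ v ⊔ e)
IsMaxTw X r = IsMax ℤ._≤_ λ k → ∃[ Γ ] Γ ⊑ X × order Γ ℕ.≤ r × IsTw Γ k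

-- The maxima and minima above exist classically, i.e. under ¬¬, so hypotheses
-- IsSep X r s and IsMaxTw X r t only name the values s and t.

private
  extremum : {A : Set a} {_≤_ : Rel A r} {P : Pred A p} → Decidable _≤_ →
             (μ : A → ℕ) → (∀ {j k} → P j → P k → ¬ (j ≤ k) → μ j ℕ.< μ k) →
             ∀ {k} → P k → ¬ ¬ ∃ (IsMax _≤_ P)
  extremum {_≤_ = _≤_} {P = P} _≤?_ μ descend Pk none = go Pk (<-wellFounded _)
    where
    go : ∀ {k} → P k → ¬ Acc ℕ._<_ (μ k)
    go {k} Pk (acc rec) = none (k , Pk , upper)
      where
      upper : ∀ {j} → P j → j ≤ k
      upper {j} Pj with j ≤? k
      ... | yes j≤k = j≤k
      ... | no  j≰k = ⊥-elim (go Pj (rec (descend Pj Pk j≰k)))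

  minℕ : {P : Pred ℕ p} → ∀ {k} → P k → ¬ ¬ ∃ (IsMin ℕ._≤_ P)
  minℕ = extremum (flip ℕ._≤?_) (λ k → k) (λ _ _ → ℕₚ.≰⇒>)

  maxℕ : {P : Pred ℕ p} → ∀ b → (∀ {k} → P k → k ℕ.≤ b) →
         ∀ {k} → P k → ¬ ¬ ∃ (IsMax ℕ._≤_ P)
  maxℕ b ≤b = extremum ℕ._≤?_ (b ℕ.∸_)
    λ Pj Pk j≰k → ℕₚ.∸-monoʳ-< (ℕₚ.≰⇒> j≰k) (≤b Pj)

  pred-mono : ∀ m n → m ℕ.≤ n → + m ℤ.- 1ℤ ℤ.≤ + n ℤ.- 1ℤ
  pred-mono m n m≤n = ℤₚ.+-monoˡ-≤ (ℤ.- 1ℤ) (+≤+ m≤n)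

  -- Transfer of existence from j : ℕ to + j - 1 : ℤ.
  shift : (_≤ℕ_ : Rel ℕ 0ℓ) (_≤ℤ_ : Rel ℤ 0ℓ) {P : Pred ℤ p} →
          (∀ m n → m ≤ℕ n → (+ m ℤ.- 1ℤ) ≤ℤ (+ n ℤ.- 1ℤ)) →
          (∀ {k} → P k → ∃[ j ] k ≡ + j ℤ.- 1ℤ) →
          ∃ (IsMax _≤ℕ_ λ j → P (+ j ℤ.- 1ℤ)) → ∃ (IsMax _≤ℤ_ P)
  shift _≤ℕ_ _≤ℤ_ {P} mono form (m , Pm , upper) = + m ℤ.- 1ℤ , Pm , upper′
    where
    upper′ : ∀ {k} → P k → k ≤ℤ (+ m ℤ.- 1ℤ)
    upper′ Pk with form Pk
    ... | j , refl = mono j m (upper Pk)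

  tw-form : ∀ Γ {k} → IsTw Γ k → ∃[ j ] k ≡ + j ℤ.- 1ℤ
  tw-form Γ ((D , (g , eq) , _) , _) = ∣ bag D g ∣ , eq

  oneBag : ∀ Γ → TreeDecomposition Γ
  oneBag Γ = record
    { tree      = record { Vertex = Unit ; _~_ = λ _ _ → Empty
                         ; ~-sym = λ z → z ; ~-irrefl = λ z → z }
    ; isTree    = record { node = tt ; connected = λ _ _ → ε
                         ; acyclic = λ c → Cycle.close c }
    ; bag       = λ _ → ⊤
    ; vertices  = λ _ → tt , ∈⊤
    ; edges     = λ _ → tt , ∈⊤ , ∈⊤
    ; connected = λ { x (tt , p) (tt , q) → subst (λ q → Star _ (tt , p) (tt , q)) (irr p q) ε }
    }
    where
    open import Data.Vec.Properties.WithK using () renaming ([]=-irrelevant to irr)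

  oneBag-width : ∀ Γ → IsWidth (oneBag Γ) (+ order Γ ℤ.- 1ℤ)
  oneBag-width Γ =
    (tt , cong (λ n → + n ℤ.- 1ℤ) (sym (∣⊤∣≡n (order Γ)))) ,
    λ { (_ , refl) → pred-mono ∣ ⊤ {order Γ} ∣ (order Γ) (ℕₚ.≤-reflexive (∣⊤∣≡n (order Γ))) }

  empty : FiniteGraph
  empty = record { order = 0 ; _~_ = λ () ; _~?_ = λ () ; ~-sym = λ { {()} }
                 ; ~-irrefl = λ { {()} } }

  empty-⊑ : (X : Graph v e) → empty ⊑ X
  empty-⊑ X = record { embed = λ () ; injective = λ { {()} } ; edge = λ { {()} } }

cut-exists : ∀ Γ → ¬ ¬ ∃ (IsCut Γ)
cut-exists Γ = minℕ (⊤ , (λ C c → ⊥-elim (noComponent c)) , refl)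
  where
  noComponent : ∀ {C} → ¬ IsComponent Γ ⊤ C
  noComponent c with IsComponent.nonempty c
  ... | _ , x∈C = IsComponent.avoids c x∈C ∈⊤

sep-exists : ∀ (X : Graph v e) r → ¬ ¬ ∃ (IsSep X r)
sep-exists X r none = cut-exists empty λ (_ , isCut) →
  maxℕ r (λ { (Γ , _ , Γ≤r , (S , _ , refl) , _) → ℕₚ.≤-trans (∣p∣≤n S) Γ≤r })
    (empty , empty-⊑ X , ℕ.z≤n , isCut) none

tw-exists : ∀ Γ → ¬ ¬ ∃ (IsTw Γ)
tw-exists Γ none = minℕ {k = order Γ} (oneBag Γ , oneBag-width Γ) λ least →
  none (shift (flip ℕ._≤_) (flip ℤ._≤_) (flip pred-mono)
              (λ { (D , (g , eq) , _) → ∣ bag D g ∣ , eq }) least)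

maxTw-exists : ∀ (X : Graph v e) r → ¬ ¬ ∃ (IsMaxTw X r)
maxTw-exists X r none = tw-exists empty λ (t , isTw) →
  start t isTw (tw-form empty isTw)
  where
  bound : ∀ j Γ → order Γ ℕ.≤ r → IsTw Γ (+ j ℤ.- 1ℤ) → j ℕ.≤ r
  bound j Γ Γ≤r (_ , least) = ℕₚ.≤-trans
    (ℤₚ.drop‿+≤+ (cancel (+ j) (+ order Γ) (least (oneBag Γ , oneBag-width Γ)))) Γ≤r
    where
    cancel : ∀ i k → i ℤ.- 1ℤ ℤ.≤ k ℤ.- 1ℤ → i ℤ.≤ k
    cancel i k h = subst₂ ℤ._≤_ (undo i) (undo k) (ℤₚ.+-monoˡ-≤ 1ℤ h)
      where
      undo : ∀ i → i ℤ.- 1ℤ ℤ.+ 1ℤ ≡ i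
      undo i = trans (ℤₚ.+-assoc i (ℤ.- 1ℤ) 1ℤ) (ℤₚ.+-identityʳ i)

  start : ∀ t → IsTw empty t → ¬ (∃[ j ] t ≡ + j ℤ.- 1ℤ)
  start _ isTw (j , refl) =
    maxℕ r (λ { {k} (Γ , _ , Γ≤r , tw) → bound k Γ Γ≤r tw })
      {k = j} (empty , empty-⊑ X , ℕ.z≤n , isTw)
      λ greatest → none (shift ℕ._≤_ ℤ._≤_ pred-mono
        (λ { (Γ , _ , _ , tw) → tw-form Γ tw }) greatest)

{-# OPTIONS --safe #-}
module Submission where

-- Lower bound.  If no bag of a tree-decomposition is a cutset, every bag g leaves a component C_g with
-- more than half of the vertices.  Any two of these meet, so on moving from g to the next node h towards
-- C_g the component C_h cannot lie back towards g, and C_h ⊆ C_g.  Following a path in the tree to a bag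
-- that contains a vertex of C_g therefore shrinks the component again and again, which is impossible.
--
-- Upper bound.  Let s bound the cuts of all subgraphs of Γ.  It suffices that every set W of vertices has
-- a balanced separator of size at most 5s: then a region P with at most 10s outer neighbours is given the
-- bag made of these neighbours, one more vertex of P and a balanced separator of all of them, at most
-- 15s + 1 vertices, and each component of what remains of P again has at most 10s outer neighbours.
--
-- If W has no such separator, consider the pairs (S, C) where |S| ≤ 5s, C is a union of components of
-- Γ − S, and C has more than half of W.  For ℓ ≥ 1 let (S, C) minimize |C| + ℓ|S|, and suppose |S| ≤ 4s.
-- By minimality no small cut separates S from the vertices outside C, so that outside C there is a set Y
-- of ℓ|S| vertices such that deleting j vertices disconnects at most ℓj vertices of Y from S.  Again by
-- minimality, deleting j vertices disconnects at most ℓj vertices of the subgraph induced on C ∪ Y from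
-- its main part, whence |C| + ℓ|S| ≤ 2ℓs as this subgraph has a cutset of size s.  On the other hand
-- |C| + ℓ|S| > 2ℓs for all pairs, by induction on ℓ: for ℓ = 1 add C to S; and if it holds for ℓ, then a
-- minimizer has |S| > 4s, so |C| + ℓ|S| > 4ℓs ≥ 2(ℓ + 1)s.  For ℓ > |VΓ| and S = ∅ this is absurd.

open import Defs
open import Data.Empty using (⊥; ⊥-elim)
open import Data.Fin as Fin using (Fin; toℕ; inject₁; fromℕ)
import Data.Fin.Properties as Finₚ
open import Data.Fin.Relation.Unary.Top using (view; ‵fromℕ; ‵inject₁)
open import Data.Fin.Subset as Subset using (Subset; inside; outside; _∈_; _∉_; _⊆_; _∪_; _∩_; _─_; ∁; ∣_∣; ⁅_⁆; Nonempty)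
open import Data.Fin.Subset.Properties
import Data.Integer as ℤ
import Data.Integer.Properties as ℤₚ
open import Data.List using (List; []; _∷_; length; lookup)
open import Data.List.Membership.Propositional using () renaming (_∈_ to _∈ₗ_)
open import Data.List.Membership.Propositional.Properties using (∈-lookup)
open import Data.List.Relation.Unary.All as All using (All; []; _∷_)
open import Data.List.Relation.Unary.All.Properties using (¬Any⇒All¬)
open import Data.List.Relation.Unary.Any using (here; there)
open import Data.Nat using (ℕ; zero; suc; _+_; _*_; _∸_; _≤_; _<_; z≤n; s≤s; s≤s⁻¹; >-nonZero)
open import Data.Nat.Properties
open import Data.Nat.Solver using (module +-*-Solver)
open import Data.Product using (∃; ∃-syntax; _×_; _,_; proj₁; proj₂; uncurry)
open import Data.Sum as Sum using (_⊎_; inj₁; inj₂; [_,_]′; swap)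
open import Data.Vec using ([]; _∷_; here; there; tabulate)
open import Data.Vec.Properties using (lookup⇒[]=; []=⇒lookup; lookup∘tabulate)
open import Data.Vec.Properties.WithK using () renaming ([]=-irrelevant to ∈-irrelevant)
open import Function using (_∘_)
open import Level using (Level; 0ℓ; _⊔_)
open import Relation.Binary using (Rel)
open import Relation.Binary.Construct.Closure.ReflexiveTransitive as Star using (Star; ε; _◅_; _◅◅_; reverse; gmap)
open import Relation.Binary.PropositionalEquality using (_≡_; _≢_; refl; sym; trans; cong; cong₂; subst; subst₂)
open import Relation.Nullary using (¬_; Dec; yes; no; does; contradiction; ¬?; _×-dec_; _⊎-dec_)
open import Relation.Nullary.Decidable using (decidable-stable; dec-true; ¬¬-excluded-middle)
open import Relation.Unary using (Pred; Decidable)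

private
  variable
    v e p q r : Level
    m : ℕ

-- Double negation and finite sets

-- `Subset m` is finite, so the double negation moves out of the quantifier one membership bit at a
-- time. This allows decompositions of all components to be chosen at once.
¬¬-choice : {F : Subset m → Set p} → (∀ p → ¬ ¬ F p) → ¬ ¬ (∀ p → F p)
¬¬-choice {m = zero}  f k = f [] λ y → k λ { [] → y }
¬¬-choice {m = suc m} f k =
  ¬¬-choice (λ p → f (inside ∷ p)) λ fᵢ →
  ¬¬-choice (λ p → f (outside ∷ p)) λ fₒ →
  k λ { (inside ∷ p) → fᵢ p ; (outside ∷ p) → fₒ p }

module _ {A : Set v} {P : A → Set p} (μ : A → ℕ) where

  -- `P` need not be decidable, so the descent to smaller values takes place under the double
  -- negation; it stops because an upper bound on the current value decreases.
  ¬¬-argmin : ∀ {x} → P x → ¬ ¬ (∃[ y ] P y × (∀ {z} → P z → μ y ≤ μ z))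
  ¬¬-argmin Px none = go _ Px ≤-refl
    where
    go : ∀ m {x} → P x → ¬ (μ x ≤ m)
    go m {x} Px μx≤m = none (x , Px , λ {z} Pz → least m μx≤m z Pz)
      where
      least : ∀ m → μ x ≤ m → ∀ z → P z → μ x ≤ μ z
      least zero    μx≤m z Pz = ≤-trans μx≤m z≤n
      least (suc m) μx≤m z Pz with μ x ≤? μ z
      ... | yes μx≤μz = μx≤μz
      ... | no  μx≰μz = ⊥-elim (go m Pz (s≤s⁻¹ (≤-trans (≰⇒> μx≰μz) μx≤m)))

¬¬-argmax : {A : Set v} {P : A → Set p} (μ : A → ℕ) (b : ℕ) → (∀ {x} → P x → μ x ≤ b) →
            ∀ {x} → P x → ¬ ¬ (∃[ y ] P y × (∀ {z} → P z → μ z ≤ μ y))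
¬¬-argmax μ b μ≤b Px none = ¬¬-argmin (λ x → b ∸ μ x) Px λ (y , Py , least) →
  none (y , Py , λ Pz → ∸-cancelʳ-≤ (μ≤b Pz) (least Pz))

∣p∪q∣+∣p∩q∣ : (p q : Subset m) → ∣ p ∪ q ∣ + ∣ p ∩ q ∣ ≡ ∣ p ∣ + ∣ q ∣
∣p∪q∣+∣p∩q∣ []          []          = refl
∣p∪q∣+∣p∩q∣ (inside ∷ p)  (inside ∷ q)  = cong suc (trans (+-suc _ _) (trans (cong suc (∣p∪q∣+∣p∩q∣ p q)) (sym (+-suc _ _))))
∣p∪q∣+∣p∩q∣ (inside ∷ p)  (outside ∷ q) = cong suc (∣p∪q∣+∣p∩q∣ p q)
∣p∪q∣+∣p∩q∣ (outside ∷ p) (inside ∷ q)  = trans (cong suc (∣p∪q∣+∣p∩q∣ p q)) (sym (+-suc _ _))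
∣p∪q∣+∣p∩q∣ (outside ∷ p) (outside ∷ q) = ∣p∪q∣+∣p∩q∣ p q

∣p∪q∣≤∣p∣+∣q∣ : (p q : Subset m) → ∣ p ∪ q ∣ ≤ ∣ p ∣ + ∣ q ∣
∣p∪q∣≤∣p∣+∣q∣ p q = ≤-trans (m≤m+n _ _) (≤-reflexive (∣p∪q∣+∣p∩q∣ p q))

Disjoint : Subset m → Subset m → Set
Disjoint p q = ∀ {x} → x ∈ p → x ∉ q

disjoint⇒∣p∪q∣ : (p q : Subset m) → Disjoint p q → ∣ p ∪ q ∣ ≡ ∣ p ∣ + ∣ q ∣
disjoint⇒∣p∪q∣ {m} p q p#q = trans (sym (trans (cong (∣ p ∪ q ∣ +_) ∣p∩q∣≡0) (+-identityʳ _))) (∣p∪q∣+∣p∩q∣ p q)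
  where
  ∣p∩q∣≡0 : ∣ p ∩ q ∣ ≡ 0
  ∣p∩q∣≡0 = trans (cong ∣_∣ (Empty-unique λ (x , x∈) → let x∈p , x∈q = x∈p∩q⁻ p q x∈ in p#q x∈p x∈q)) (∣⊥∣≡0 m)

x∈p─q⁻ : ∀ {x} (p q : Subset m) → x ∈ p ─ q → x ∈ p × x ∉ q
x∈p─q⁻ (inside ∷ p)  (outside ∷ q) here = here , λ ()
x∈p─q⁻ (_ ∷ p) (inside ∷ q)  (there x∈) with x∈p─q⁻ p q x∈
... | x∈p , x∉q = there x∈p , λ { (there x∈q) → x∉q x∈q }
x∈p─q⁻ (_ ∷ p) (outside ∷ q) (there x∈) with x∈p─q⁻ p q x∈
... | x∈p , x∉q = there x∈p , λ { (there x∈q) → x∉q x∈q }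

∣p∩q∣+∣p─q∣ : (p q : Subset m) → ∣ p ∩ q ∣ + ∣ p ─ q ∣ ≡ ∣ p ∣
∣p∩q∣+∣p─q∣ []          []          = refl
∣p∩q∣+∣p─q∣ (inside ∷ p)  (inside ∷ q)  = cong suc (∣p∩q∣+∣p─q∣ p q)
∣p∩q∣+∣p─q∣ (inside ∷ p)  (outside ∷ q) = trans (+-suc _ _) (cong suc (∣p∩q∣+∣p─q∣ p q))
∣p∩q∣+∣p─q∣ (outside ∷ p) (inside ∷ q)  = ∣p∩q∣+∣p─q∣ p q
∣p∩q∣+∣p─q∣ (outside ∷ p) (outside ∷ q) = ∣p∩q∣+∣p─q∣ p q

p⊆q∧∣q∣≤∣p∣⇒q⊆p : (p q : Subset m) → p ⊆ q → ∣ q ∣ ≤ ∣ p ∣ → q ⊆ p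
p⊆q∧∣q∣≤∣p∣⇒q⊆p p q p⊆q ∣q∣≤∣p∣ {x} x∈q with x ∈? p
... | yes x∈p = x∈p
... | no  x∉p = contradiction (<-≤-trans (p⊂q⇒∣p∣<∣q∣ (p⊆q , x , x∈q , x∉p)) ∣q∣≤∣p∣) (<-irrefl refl)

intersects : (p q : Subset m) {k : ℕ} → ∣ p ∪ q ∣ ≤ k → k < 2 * ∣ p ∣ → k < 2 * ∣ q ∣ → Nonempty (p ∩ q)
intersects p q {k} p∪q≤k k<2p k<2q with nonempty? (p ∩ q)
... | yes ne = ne
... | no empty = contradiction k+k<k+k (<-irrefl refl)
  where
  ∣p∣+∣q∣≤k : ∣ p ∣ + ∣ q ∣ ≤ k
  ∣p∣+∣q∣≤k = ≤-trans (≤-reflexive (sym (disjoint⇒∣p∪q∣ p q λ x∈p x∈q → empty (_ , x∈p∩q⁺ (x∈p , x∈q))))) p∪q≤k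
  open ≤-Reasoning
  k+k<k+k : 2 * k < 2 * k
  k+k<k+k = begin-strict
    2 * k                 ≡⟨ cong (k +_) (+-identityʳ k) ⟩
    k + k                 <⟨ +-mono-< k<2p k<2q ⟩
    2 * ∣ p ∣ + 2 * ∣ q ∣ ≡⟨ sym (*-distribˡ-+ 2 ∣ p ∣ ∣ q ∣) ⟩
    2 * (∣ p ∣ + ∣ q ∣)   ≤⟨ *-monoʳ-≤ 2 ∣p∣+∣q∣≤k ⟩
    2 * k                 ∎

⟪_⟫ : {P : Pred (Fin m) p} → Decidable P → Subset m
⟪ P? ⟫ = tabulate (does ∘ P?)

module _ {P : Pred (Fin m) p} (P? : Decidable P) where

  ∈⟪⟫⁺ : ∀ {x} → P x → x ∈ ⟪ P? ⟫
  ∈⟪⟫⁺ {x} Px = lookup⇒[]= x _ (trans (lookup∘tabulate _ x) (dec-true (P? x) Px))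

  ∈⟪⟫⁻ : ∀ {x} → x ∈ ⟪ P? ⟫ → P x
  ∈⟪⟫⁻ {x} x∈ with P? x | trans (sym (lookup∘tabulate (does ∘ P?) x)) ([]=⇒lookup x∈)
  ... | yes Px | _ = Px
  ... | no _   | ()

-- Connected sets of vertices

module _ (G : Graph v e) {P : Pred (Graph.Vertex G) p} {Q : Pred (Graph.Vertex G) q}
         (P⊆Q : ∀ {x} → P x → Q x) (Q-irrelevant : ∀ {x} (r s : Q x) → r ≡ s) where

  -- Vertices of a full subgraph carry membership proofs; irrelevance lets the ends of the new walk
  -- carry arbitrary ones.
  full-mono : ∀ {x y} → Star (Graph._~_ (full G P)) x y →
              ∀ r s → Star (Graph._~_ (full G Q)) (proj₁ x , r) (proj₁ y , s)
  full-mono {x , _} ε r s = subst (λ s → Star _ (x , r) (x , s)) (Q-irrelevant r s) ε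
  full-mono (_◅_ {j = _ , Py} x~y w) r s = x~y ◅ full-mono w (P⊆Q Py) s

module Connectivity (Γ : FiniteGraph) where
  open FiniteGraph Γ using (_~_; ~-sym) renaming (order to n)

  Conn : Subset n → Set
  Conn D = Connected (full (graph Γ) (_∈ D))

  Walk : (D : Subset n) → ∃ (_∈ D) → ∃ (_∈ D) → Set
  Walk D = Star (Graph._~_ (full (graph Γ) (_∈ D)))

  widen : ∀ {D E x y} → D ⊆ E → Walk D x y → ∀ p q → Walk E (proj₁ x , p) (proj₁ y , q)
  widen D⊆E = full-mono (graph Γ) D⊆E ∈-irrelevant

  conn-⁅⁆ : ∀ x → Conn ⁅ x ⁆
  conn-⁅⁆ x (y , y∈) (z , z∈) with x∈⁅y⁆⇒x≡y x y∈ | x∈⁅y⁆⇒x≡y x z∈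
  ... | refl | refl = widen {D = ⁅ x ⁆} {x = _ , y∈} (λ p → p) ε y∈ z∈

  conn-∪ : ∀ {D E x y} → Conn D → Conn E → x ∈ D → y ∈ E → x ≡ y ⊎ x ~ y → Conn (D ∪ E)
  conn-∪ {D} {E} {x} {y} cD cE x∈D y∈E link = conn
    where
    inD : ∀ {a} → a ∈ D → a ∈ D ∪ E
    inD = p⊆p∪q E
    inE : ∀ {a} → a ∈ E → a ∈ D ∪ E
    inE = q⊆p∪q D E
    W : ∃ (_∈ D ∪ E) → ∃ (_∈ D ∪ E) → Set
    W = Walk (D ∪ E)
    bridge : ∀ p q → x ≡ y ⊎ x ~ y → W (x , p) (y , q)
    bridge p q (inj₁ refl) = widen {D = D ∪ E} {x = _ , p} (λ r → r) ε p q
    bridge p q (inj₂ x~y)  = x~y ◅ ε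
    toX : ∀ {a} p → a ∈ D ⊎ a ∈ E → W (a , p) (x , inD x∈D)
    toX p (inj₁ a∈D) = widen inD (cD (_ , a∈D) (_ , x∈D)) p (inD x∈D)
    toX p (inj₂ a∈E) = widen inE (cE (_ , a∈E) (_ , y∈E)) p (inE y∈E) ◅◅ reverse ~-sym (bridge (inD x∈D) (inE y∈E) link)
    conn : Conn (D ∪ E)
    conn (a , a∈) (b , b∈) = toX a∈ (x∈p∪q⁻ D E a∈) ◅◅ reverse ~-sym (toX b∈ (x∈p∪q⁻ D E b∈))

  Closed : Subset n → Subset n → Set
  Closed S C = ∀ {x y} → x ∈ C → x ~ y → y ∉ S → y ∈ C

  -- A walk can leave `C` only through `S`, which `D` avoids.
  stays : ∀ {S C D} → Closed S C → Conn D → Disjoint D S → Nonempty (D ∩ C) → D ⊆ C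
  stays {S} {C} {D} closed conn D#S (z , z∈) {x} x∈D =
    let z∈D , z∈C = x∈p∩q⁻ D C z∈ in go (conn (z , z∈D) (x , x∈D)) z∈C
    where
    go : ∀ {a b} → Walk D a b → proj₁ a ∈ C → proj₁ b ∈ C
    go ε a∈C = a∈C
    go (_◅_ {j = _ , y∈D} a~y w) a∈C = go w (closed a∈C a~y (D#S y∈D))

  MaximalConn : Subset n → Subset n → Set
  MaximalConn B D = D ⊆ B × Conn D × (∀ E → D ⊆ E → E ⊆ B → Conn E → E ⊆ D)

  -- Among the connected sets between `D` and `B`, one of largest cardinality is also maximal under
  -- inclusion.
  grow : ∀ {B D} → D ⊆ B → Conn D → ¬ ¬ (∃[ D′ ] D ⊆ D′ × MaximalConn B D′)
  grow {B} {D} D⊆B conn none =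
    ¬¬-argmax {P = λ E → D ⊆ E × E ⊆ B × Conn E} ∣_∣ n (λ {E} _ → ∣p∣≤n E) ((λ p → p) , D⊆B , conn)
      λ { (D′ , (D⊆D′ , D′⊆B , conn′) , largest) → none (D′ , D⊆D′ , D′⊆B , conn′ ,
          λ E D′⊆E E⊆B connE → p⊆q∧∣q∣≤∣p∣⇒q⊆p D′ E D′⊆E
            (largest ((λ p → D′⊆E (D⊆D′ p)) , E⊆B , connE))) }

  absorb : ∀ {B D x y} → MaximalConn B D → x ∈ D → x ~ y → y ∈ B → y ∈ D
  absorb {B} {D} {x} {y} (D⊆B , conn , max) x∈D x~y y∈B =
    max (D ∪ ⁅ y ⁆) (p⊆p∪q _)
      (λ z∈ → [ D⊆B , (λ z∈⁅y⁆ → subst (_∈ B) (sym (x∈⁅y⁆⇒x≡y y z∈⁅y⁆)) y∈B) ]′ (x∈p∪q⁻ D _ z∈))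
      (conn-∪ conn (conn-⁅⁆ y) x∈D (x∈⁅x⁆ y) (inj₂ x~y))
      (q⊆p∪q D _ (x∈⁅x⁆ y))

-- Robust sets and minimum cuts

-- Sets that can be reached from S by paths of which at most ℓ use any given vertex, described by
-- the cut condition of the max-flow min-cut theorem.
module Robustness (Γ : FiniteGraph) (S : Subset (order Γ)) (ℓ : ℕ) (1≤ℓ : 1 ≤ ℓ) where
  open FiniteGraph Γ using (_~_; _~?_; ~-sym) renaming (order to n)

  -- These are the vertices at which paths in `Y` starting in `S` enter `U`; deleting them cuts the
  -- rest of `U` off from `S` within `Y`.
  Boundary : Subset n → Subset n → Pred (Fin n) _
  Boundary Y U u = u ∈ U × (u ∈ S ⊎ ∃[ v ] v ∈ Y × v ∉ U × u ~ v)

  boundary? : ∀ Y U → Decidable (Boundary Y U)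
  boundary? Y U u = u ∈? U ×-dec (u ∈? S ⊎-dec Finₚ.any? λ v → v ∈? Y ×-dec (¬? (v ∈? U) ×-dec (u ~? v)))

  ∂ : Subset n → Subset n → Subset n
  ∂ Y U = ⟪ boundary? Y U ⟫

  Robust : Subset n → Set
  Robust Y = ∀ U → U ⊆ Y → ∣ U ∣ ≤ ℓ * ∣ ∂ Y U ∣

  Tight : Subset n → Subset n → Set
  Tight Y U = U ⊆ Y × ℓ * ∣ ∂ Y U ∣ ≤ ∣ U ∣

  ∂⁻ : ∀ Y U {u} → u ∈ ∂ Y U → Boundary Y U u
  ∂⁻ Y U = ∈⟪⟫⁻ (boundary? Y U)

  ∂⁺ : ∀ Y U {u} → Boundary Y U u → u ∈ ∂ Y U
  ∂⁺ Y U = ∈⟪⟫⁺ (boundary? Y U)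

  -- A vertex in one of the boundaries on the left lies in one on the right, and a vertex in both on
  -- the left lies in both on the right.
  ∂-submodular : ∀ Y U V → ∣ ∂ Y (U ∪ V) ∣ + ∣ ∂ Y (U ∩ V) ∣ ≤ ∣ ∂ Y U ∣ + ∣ ∂ Y V ∣
  ∂-submodular Y U V = begin
    ∣ a ∣ + ∣ b ∣         ≡⟨ ∣p∪q∣+∣p∩q∣ a b ⟨
    ∣ a ∪ b ∣ + ∣ a ∩ b ∣ ≤⟨ +-mono-≤ (p⊆q⇒∣p∣≤∣q∣ λ u∈ → [ ∂-∪ , ∂-∩ ]′ (x∈p∪q⁻ a b u∈))
                                      (p⊆q⇒∣p∣≤∣q∣ λ u∈ → let u∈a , u∈b = x∈p∩q⁻ a b u∈ in both u∈a u∈b) ⟩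
    ∣ c ∪ d ∣ + ∣ c ∩ d ∣ ≡⟨ ∣p∪q∣+∣p∩q∣ c d ⟩
    ∣ c ∣ + ∣ d ∣         ∎
    where
    open ≤-Reasoning
    a = ∂ Y (U ∪ V)
    b = ∂ Y (U ∩ V)
    c = ∂ Y U
    d = ∂ Y V
    left : ∀ {u} → Boundary Y (U ∪ V) u → u ∈ U → u ∈ c
    left (_ , s) u∈U = ∂⁺ Y U (u∈U , Sum.map₂ (λ { (v , v∈Y , v∉ , u~v) → v , v∈Y , (λ v∈U → v∉ (p⊆p∪q V v∈U)) , u~v }) s)
    right : ∀ {u} → Boundary Y (U ∪ V) u → u ∈ V → u ∈ d
    right (_ , s) u∈V = ∂⁺ Y V (u∈V , Sum.map₂ (λ { (v , v∈Y , v∉ , u~v) → v , v∈Y , (λ v∈V → v∉ (q⊆p∪q U V v∈V)) , u~v }) s)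
    ∂-∪ : ∀ {u} → u ∈ a → u ∈ c ∪ d
    ∂-∪ u∈a with ∂⁻ Y (U ∪ V) u∈a
    ... | bd = x∈p∪q⁺ (Sum.map (left bd) (right bd) (x∈p∪q⁻ U V (proj₁ bd)))
    ∂-∩ : ∀ {u} → u ∈ b → u ∈ c ∪ d
    ∂-∩ u∈b with ∂⁻ Y (U ∩ V) u∈b
    ... | u∈ , inj₁ u∈S = p⊆p∪q d (∂⁺ Y U (p∩q⊆p U V u∈ , inj₁ u∈S))
    ... | u∈ , inj₂ (v , v∈Y , v∉ , u~v) with v ∈? U
    ...   | no v∉U  = p⊆p∪q d (∂⁺ Y U (p∩q⊆p U V u∈ , inj₂ (v , v∈Y , v∉U , u~v)))
    ...   | yes v∈U = q⊆p∪q c d (∂⁺ Y V (p∩q⊆q U V u∈ , inj₂ (v , v∈Y , (λ v∈V → v∉ (x∈p∩q⁺ (v∈U , v∈V))) , u~v)))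
    both : ∀ {u} → u ∈ a → u ∈ b → u ∈ c ∩ d
    both u∈a u∈b =
      let bd = ∂⁻ Y (U ∪ V) u∈a
          u∈U , u∈V = x∈p∩q⁻ U V (proj₁ (∂⁻ Y (U ∩ V) u∈b))
      in x∈p∩q⁺ (left bd u∈U , right bd u∈V)

  -- Uncrossing: by submodularity any slack in the union would violate robustness at the
  -- intersection. Hence a tight set of largest size contains every tight set.
  tight-∪ : ∀ {Y U V} → Robust Y → Tight Y U → Tight Y V → Tight Y (U ∪ V)
  tight-∪ {Y} {U} {V} robust (U⊆Y , tU) (V⊆Y , tV) =
    (λ u∈ → [ U⊆Y , V⊆Y ]′ (x∈p∪q⁻ U V u∈)) , +-cancelʳ-≤ ∣ U ∩ V ∣ _ _ (begin
      ℓ * ∣ ∂ Y (U ∪ V) ∣ + ∣ U ∩ V ∣             ≤⟨ +-monoʳ-≤ _ (robust (U ∩ V) (U⊆Y ∘ p∩q⊆p U V)) ⟩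
      ℓ * ∣ ∂ Y (U ∪ V) ∣ + ℓ * ∣ ∂ Y (U ∩ V) ∣   ≡⟨ *-distribˡ-+ ℓ ∣ ∂ Y (U ∪ V) ∣ ∣ ∂ Y (U ∩ V) ∣ ⟨
      ℓ * (∣ ∂ Y (U ∪ V) ∣ + ∣ ∂ Y (U ∩ V) ∣)     ≤⟨ *-monoʳ-≤ ℓ (∂-submodular Y U V) ⟩
      ℓ * (∣ ∂ Y U ∣ + ∣ ∂ Y V ∣)                 ≡⟨ *-distribˡ-+ ℓ ∣ ∂ Y U ∣ ∣ ∂ Y V ∣ ⟩
      ℓ * ∣ ∂ Y U ∣ + ℓ * ∣ ∂ Y V ∣               ≤⟨ +-mono-≤ tU tV ⟩
      ∣ U ∣ + ∣ V ∣                               ≡⟨ ∣p∪q∣+∣p∩q∣ U V ⟨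
      ∣ U ∪ V ∣ + ∣ U ∩ V ∣                       ∎)
    where open ≤-Reasoning

  -- Only sets `V` containing `y` matter, and `y` adds one to the size of `V⁻`. If `y` is on the
  -- boundary of `V`, this pays ℓ ≥ 1; if `V⁻` is not tight, its slack pays. A tight `V⁻` lies in
  -- `U`, so the vertex `p` from which `y` is reached is outside `V`, or `y` is in `S`; either way
  -- `y` is on the boundary.
  robust-extend : ∀ {Y U y} → Robust Y → (∀ {V} → Tight Y V → V ⊆ U) → y ∉ Y →
                  y ∈ S ⊎ (∃[ p ] p ∈ Y × p ∉ U × p ~ y) → Robust (Y ∪ ⁅ y ⁆)
  robust-extend {Y} {U} {y} robust largest y∉Y reach V V⊆Y′ with y ∈? V
  ... | no y∉V = ≤-trans (robust V V⊆Y) (*-monoʳ-≤ ℓ (p⊆q⇒∣p∣≤∣q∣ ∂⊆∂))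
    where
    V⊆Y : V ⊆ Y
    V⊆Y v∈V = [ (λ v∈Y → v∈Y) , (λ v∈⁅y⁆ → contradiction (subst (_∈ V) (x∈⁅y⁆⇒x≡y y v∈⁅y⁆) v∈V) y∉V) ]′ (x∈p∪q⁻ Y _ (V⊆Y′ v∈V))
    ∂⊆∂ : ∂ Y V ⊆ ∂ (Y ∪ ⁅ y ⁆) V
    ∂⊆∂ u∈ with ∂⁻ Y V u∈
    ... | u∈V , s = ∂⁺ (Y ∪ ⁅ y ⁆) V (u∈V , Sum.map₂ (λ { (v , v∈Y , r) → v , p⊆p∪q _ v∈Y , r }) s)
  ... | yes y∈V = bound
    where
    open ≤-Reasoning
    Y′ = Y ∪ ⁅ y ⁆
    V⁻ = V ─ ⁅ y ⁆

    V⁻⊆Y : V⁻ ⊆ Y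
    V⁻⊆Y v∈ with x∈p─q⁻ V ⁅ y ⁆ v∈
    ... | v∈V , v∉⁅y⁆ = [ (λ v∈Y → v∈Y) , (λ v∈⁅y⁆ → contradiction v∈⁅y⁆ v∉⁅y⁆) ]′ (x∈p∪q⁻ Y _ (V⊆Y′ v∈V))

    ∣V∣≤ : ∣ V ∣ ≤ suc ∣ V⁻ ∣
    ∣V∣≤ = begin
      ∣ V ∣                  ≡⟨ ∣p∩q∣+∣p─q∣ V ⁅ y ⁆ ⟨
      ∣ V ∩ ⁅ y ⁆ ∣ + ∣ V⁻ ∣ ≤⟨ +-monoˡ-≤ ∣ V⁻ ∣ (∣p∩q∣≤∣q∣ V ⁅ y ⁆) ⟩
      ∣ ⁅ y ⁆ ∣ + ∣ V⁻ ∣     ≡⟨ cong (_+ ∣ V⁻ ∣) (∣⁅x⁆∣≡1 y) ⟩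
      suc ∣ V⁻ ∣             ∎

    ∂⊆∂ : ∂ Y V⁻ ⊆ ∂ Y′ V
    ∂⊆∂ u∈ with ∂⁻ Y V⁻ u∈
    ... | u∈V⁻ , s = ∂⁺ Y′ V (p─q⊆p V _ u∈V⁻ , Sum.map₂ (λ { (v , v∈Y , v∉V⁻ , u~v) → v , p⊆p∪q _ v∈Y ,
            (λ v∈V → v∉V⁻ (x∈p∧x∉q⇒x∈p─q v∈V λ v∈⁅y⁆ → y∉Y (subst (_∈ Y) (x∈⁅y⁆⇒x≡y y v∈⁅y⁆) v∈Y))) , u~v }) s)

    bound : ∣ V ∣ ≤ ℓ * ∣ ∂ Y′ V ∣
    bound with y ∈? ∂ Y′ V
    ... | yes y∈∂ = begin
      ∣ V ∣                            ≤⟨ ∣V∣≤ ⟩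
      1 + ∣ V⁻ ∣                       ≤⟨ +-mono-≤ 1≤ℓ (robust V⁻ V⁻⊆Y) ⟩
      ℓ + ℓ * ∣ ∂ Y V⁻ ∣               ≡⟨ *-suc ℓ ∣ ∂ Y V⁻ ∣ ⟨
      ℓ * suc ∣ ∂ Y V⁻ ∣               ≤⟨ *-monoʳ-≤ ℓ (p⊂q⇒∣p∣<∣q∣ (∂⊆∂ , y , y∈∂ , y∉∂)) ⟩
      ℓ * ∣ ∂ Y′ V ∣                   ∎
      where
      y∉∂ : y ∉ ∂ Y V⁻
      y∉∂ y∈ = y∉Y (V⁻⊆Y (proj₁ (∂⁻ Y V⁻ y∈)))
    ... | no y∉∂ with ℓ * ∣ ∂ Y V⁻ ∣ ≤? ∣ V⁻ ∣
    ...   | no slack = ≤-trans ∣V∣≤ (≤-trans (≰⇒> slack) (*-monoʳ-≤ ℓ (p⊆q⇒∣p∣≤∣q∣ ∂⊆∂)))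
    ...   | yes tight = contradiction reach unreached
      where
      unreached : ¬ (y ∈ S ⊎ (∃[ p ] p ∈ Y × p ∉ U × p ~ y))
      unreached (inj₁ y∈S) = y∉∂ (∂⁺ Y′ V (y∈V , inj₁ y∈S))
      unreached (inj₂ (p , p∈Y , p∉U , p~y)) = y∉∂ (∂⁺ Y′ V (y∈V , inj₂ (p , p⊆p∪q _ p∈Y ,
        (λ p∈V → p∉U (largest (V⁻⊆Y , tight) (x∈p∧x∉q⇒x∈p─q p∈V λ p∈⁅y⁆ → y∉Y (subst (_∈ Y) (x∈⁅y⁆⇒x≡y y p∈⁅y⁆) p∈Y)))) ,
        ~-sym p~y)))

  -- U is a minimum cut: outside C, the vertices of Y beyond U have no neighbours other than in Y.
  record Saturated (C : Subset n) : Set where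
    field
      Y U      : Subset n
      disjoint : Disjoint Y C
      robust   : Robust Y
      tight    : Tight Y U
      roots    : ∀ {y} → y ∈ S → y ∉ C → y ∈ Y
      fence    : ∀ {p y} → p ∈ Y → p ∉ U → p ~ y → y ∉ C → y ∈ Y

  -- Take `Y` robust, disjoint from `C` and of largest size, then `U` tight of largest size. A
  -- vertex violating `roots` or `fence` could be added to `Y` by `robust-extend`.
  saturate : ∀ C → ¬ ¬ Saturated C
  saturate C none =
    ¬¬-argmax {P = λ Y → Disjoint Y C × Robust Y} ∣_∣ n (λ {Y} _ → ∣p∣≤n Y) {Subset.⊥}
      ((λ y∈⊥ _ → ∉⊥ y∈⊥) , λ U U⊆⊥ → ≤-trans (≤-trans (p⊆q⇒∣p∣≤∣q∣ U⊆⊥) (≤-reflexive (∣⊥∣≡0 n))) z≤n)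
      λ { (Y , (disjoint , robust) , largestY) →
    ¬¬-argmax {P = Tight Y} ∣_∣ n (λ {U} _ → ∣p∣≤n U) {Subset.⊥} (empty-tight Y)
      λ { (U , tight , largestU) → none (build Y disjoint robust largestY U tight λ {V} tV →
          λ v∈V → p⊆q∧∣q∣≤∣p∣⇒q⊆p U (U ∪ V) (p⊆p∪q V) (largestU (tight-∪ robust tight tV)) (q⊆p∪q U V v∈V)) } }
    where
    empty-tight : ∀ Y → Tight Y Subset.⊥
    empty-tight Y = ⊆-min Y , ≤-trans (≤-reflexive (trans (cong (ℓ *_) ∣∂⊥∣≡0) (*-zeroʳ ℓ))) z≤n
      where
      ∣∂⊥∣≡0 : ∣ ∂ Y Subset.⊥ ∣ ≡ 0
      ∣∂⊥∣≡0 = n≤0⇒n≡0 (≤-trans (p⊆q⇒∣p∣≤∣q∣ {q = Subset.⊥} λ u∈ → proj₁ (∂⁻ Y Subset.⊥ u∈)) (≤-reflexive (∣⊥∣≡0 n)))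

    build : ∀ Y → Disjoint Y C → Robust Y → (∀ {Z} → Disjoint Z C × Robust Z → ∣ Z ∣ ≤ ∣ Y ∣) →
            ∀ U → Tight Y U → (∀ {V} → Tight Y V → V ⊆ U) → Saturated C
    build Y disjoint robust largestY U tight largestU = record
      { Y = Y ; U = U ; disjoint = disjoint ; robust = robust ; tight = tight
      ; roots = λ y∈S y∉C → absorbed y∉C (inj₁ y∈S)
      ; fence = λ p∈Y p∉U p~y y∉C → absorbed y∉C (inj₂ (_ , p∈Y , p∉U , p~y)) }
      where
      absorbed : ∀ {y} → y ∉ C → y ∈ S ⊎ (∃[ p ] p ∈ Y × p ∉ U × p ~ y) → y ∈ Y
      absorbed {y} y∉C reach with y ∈? Y
      ... | yes y∈Y = y∈Y
      ... | no  y∉Y = p⊆q∧∣q∣≤∣p∣⇒q⊆p Y (Y ∪ ⁅ y ⁆) (p⊆p∪q _)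
        (largestY ((λ z∈ z∈C → [ (λ z∈Y → disjoint z∈Y z∈C) , (λ z∈⁅y⁆ → y∉C (subst (_∈ C) (x∈⁅y⁆⇒x≡y y z∈⁅y⁆) z∈C)) ]′ (x∈p∪q⁻ Y _ z∈)) ,
                   robust-extend robust largestU y∉Y reach))
        (q⊆p∪q Y _ (x∈⁅x⁆ y))

-- Balanced separators from small cutsets

module Separation (Γ : FiniteGraph) where
  open FiniteGraph Γ using (_~_; _~?_; ~-sym) renaming (order to n)
  open Connectivity Γ

  HalvesAfter : Subset n → Subset n → Set
  HalvesAfter B Z = ∀ D → D ⊆ B → Disjoint D Z → Conn D → 2 * ∣ D ∣ ≤ ∣ B ∣

  Separable : ℕ → Set
  Separable s = ∀ B → ¬ ¬ (∃[ Z ] ∣ Z ∣ ≤ s × HalvesAfter B Z)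

  BalancedSeparator : ℕ → Subset n → Subset n → Set
  BalancedSeparator k W S = ∣ S ∣ ≤ k × (∀ D → Conn D → Disjoint D S → 2 * ∣ D ∩ W ∣ ≤ ∣ W ∣)

  module _ {s : ℕ} (separable : Separable s) (W : Subset n)
           (none : ¬ ∃ (BalancedSeparator (5 * s) W)) where

    Majority : Subset n → Set
    Majority C = ∣ W ∣ < 2 * ∣ C ∩ W ∣

    majority-⊆ : ∀ {C D} → C ⊆ D → Majority C → Majority D
    majority-⊆ {C} {D} C⊆D m = <-≤-trans m (*-monoʳ-≤ 2 (p⊆q⇒∣p∣≤∣q∣ λ x∈ →
      let x∈C , x∈W = x∈p∩q⁻ C W x∈ in x∈p∩q⁺ (C⊆D x∈C , x∈W)))

    majorities-meet : ∀ {C D} → Majority C → Majority D → Nonempty (C ∩ D)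
    majorities-meet {C} {D} mC mD =
      let x , x∈ = intersects (C ∩ W) (D ∩ W)
                     (p⊆q⇒∣p∣≤∣q∣ λ x∈ → [ p∩q⊆q C W , p∩q⊆q D W ]′ (x∈p∪q⁻ (C ∩ W) (D ∩ W) x∈)) mC mD
          x∈CW , x∈DW = x∈p∩q⁻ (C ∩ W) (D ∩ W) x∈
      in x , x∈p∩q⁺ (p∩q⊆p C W x∈CW , p∩q⊆p D W x∈DW)

    -- As `S` is no balanced separator, some connected set avoiding it has a majority; growing it to
    -- a component makes it closed.
    big : ∀ S → ∣ S ∣ ≤ 5 * s → ¬ ¬ (∃[ D ] Conn D × Disjoint D S × Closed S D × Majority D)
    big S ∣S∣≤ no-D = none (S , ∣S∣≤ , λ D conn D#S → ≮⇒≥ λ mD →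
      grow {B = ∁ S} (λ x∈D → x∉p⇒x∈∁p (D#S x∈D)) conn λ { (D′ , D⊆D′ , D′-max@(D′⊆∁S , conn′ , _)) →
        no-D (D′ , conn′ , x∈∁p⇒x∉p ∘ D′⊆∁S , (λ x∈D′ x~y y∉S → absorb D′-max x∈D′ x~y (x∉p⇒x∈∁p y∉S)) ,
              majority-⊆ D⊆D′ mD) })

    record Side (S C : Subset n) : Set where
      field
        small    : ∣ S ∣ ≤ 5 * s
        disjoint : Disjoint C S
        closed   : Closed S C
        majority : Majority C

    Φ : ℕ → Subset n × Subset n → ℕ
    Φ ℓ (S , C) = ∣ C ∣ + ℓ * ∣ S ∣

    -- The letters are the sizes of `C`, `S₀`, `S ─ S₀`, `D₀`, `Z ∩ C`, `Z ─ C`, `Y`, `D` and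
    -- `Y ─ D` (in the order c, s₀, w, d₀, zᵢ, zₒ, y, d, u). Adding the first three inequalities
    -- cancels the terms in s₀ and w and leaves c + y ≤ d + ℓs, which is then doubled.
    accounting : ∀ {c ℓ s₀ w d₀ zᵢ zₒ y d u} → c + ℓ * (s₀ + w) ≤ d₀ + ℓ * (s₀ + zᵢ) → u ≤ ℓ * (zₒ + w) →
                 d₀ + y ≤ d + u → zᵢ + zₒ ≤ s → 2 * d ≤ c + y → c + y ≤ 2 * (ℓ * s)
    accounting {c} {ℓ} {s₀} {w} {d₀} {zᵢ} {zₒ} {y} {d} {u} minimal u≤ d₀+y≤ z≤s 2d≤ =
      +-cancelˡ-≤ (c + y) _ _ (begin
        (c + y) + (c + y)       ≡⟨ cong ((c + y) +_) (+-identityʳ (c + y)) ⟨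
        2 * (c + y)             ≤⟨ *-monoʳ-≤ 2 c+y≤ ⟩
        2 * (d + ℓ * s)         ≡⟨ *-distribˡ-+ 2 d (ℓ * s) ⟩
        2 * d + 2 * (ℓ * s)     ≤⟨ +-monoˡ-≤ _ 2d≤ ⟩
        (c + y) + 2 * (ℓ * s)   ∎)
      where
      open ≤-Reasoning
      open +-*-Solver
      c+y≤ : c + y ≤ d + ℓ * s
      c+y≤ = +-cancelʳ-≤ (ℓ * s₀ + ℓ * w) _ _ (begin
        c + y + (ℓ * s₀ + ℓ * w)
          ≡⟨ solve 5 (λ c y ℓ s₀ w → c :+ y :+ (ℓ :* s₀ :+ ℓ :* w) := c :+ ℓ :* (s₀ :+ w) :+ y) refl c y ℓ s₀ w ⟩
        c + ℓ * (s₀ + w) + y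
          ≤⟨ +-monoˡ-≤ y minimal ⟩
        d₀ + ℓ * (s₀ + zᵢ) + y
          ≡⟨ solve 3 (λ d₀ e y → d₀ :+ e :+ y := (d₀ :+ y) :+ e) refl d₀ (ℓ * (s₀ + zᵢ)) y ⟩
        d₀ + y + ℓ * (s₀ + zᵢ)
          ≤⟨ +-monoˡ-≤ _ (≤-trans d₀+y≤ (+-monoʳ-≤ d u≤)) ⟩
        d + ℓ * (zₒ + w) + ℓ * (s₀ + zᵢ)
          ≡⟨ solve 6 (λ d ℓ zₒ w s₀ zᵢ → d :+ ℓ :* (zₒ :+ w) :+ ℓ :* (s₀ :+ zᵢ) :=
                                         d :+ ℓ :* (zᵢ :+ zₒ) :+ (ℓ :* s₀ :+ ℓ :* w)) refl d ℓ zₒ w s₀ zᵢ ⟩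
        d + ℓ * (zᵢ + zₒ) + (ℓ * s₀ + ℓ * w)
          ≤⟨ +-monoˡ-≤ _ (+-monoʳ-≤ d (*-monoʳ-≤ ℓ z≤s)) ⟩
        d + ℓ * s + (ℓ * s₀ + ℓ * w) ∎)

    module Minimizer (ℓ : ℕ) (1≤ℓ : 1 ≤ ℓ) {S C : Subset n} (side : Side S C)
                     (minimal : ∀ {S′ C′} → Side S′ C′ → Φ ℓ (S , C) ≤ Φ ℓ (S′ , C′)) where
      open Side side
      open Robustness Γ S ℓ 1≤ℓ

      module _ (sat : Saturated C) where
        open Saturated sat renaming (disjoint to Y#C)

        -- Replacing `S` by the cut `∂ Y U` adds at most |Y ─ U| to the size of `C`, and tightness
        -- bounds the weighted cut by |U|; together these make up |Y|.
        push : Side (∂ Y U) (C ∪ (Y ─ U)) → ℓ * ∣ S ∣ ≤ ∣ Y ∣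
        push side′ = +-cancelˡ-≤ ∣ C ∣ _ _ (begin
          ∣ C ∣ + ℓ * ∣ S ∣                 ≤⟨ minimal side′ ⟩
          ∣ C ∪ (Y ─ U) ∣ + ℓ * ∣ ∂ Y U ∣   ≤⟨ +-mono-≤ (∣p∪q∣≤∣p∣+∣q∣ C (Y ─ U)) (proj₂ tight) ⟩
          ∣ C ∣ + ∣ Y ─ U ∣ + ∣ U ∣         ≡⟨ +-assoc ∣ C ∣ _ _ ⟩
          ∣ C ∣ + (∣ Y ─ U ∣ + ∣ U ∣)       ≤⟨ +-monoʳ-≤ ∣ C ∣ (+-monoʳ-≤ ∣ Y ─ U ∣ (p⊆q⇒∣p∣≤∣q∣ λ u∈U → x∈p∩q⁺ (proj₁ tight u∈U , u∈U))) ⟩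
          ∣ C ∣ + (∣ Y ─ U ∣ + ∣ Y ∩ U ∣)   ≡⟨ cong (∣ C ∣ +_) (trans (+-comm ∣ Y ─ U ∣ _) (∣p∩q∣+∣p─q∣ Y U)) ⟩
          ∣ C ∣ + ∣ Y ∣                     ∎)
          where open ≤-Reasoning

        -- Tightness gives ℓ|∂ Y U| ≤ |Y| < ℓ|S|, so the new separator is smaller than `S`. Edges
        -- leaving `C` end in `S` and are caught by `roots`; those leaving `Y ─ U` are caught by
        -- `fence`.
        pushed-side : ∣ Y ∣ < ℓ * ∣ S ∣ → Side (∂ Y U) (C ∪ (Y ─ U))
        pushed-side ∣Y∣< = record
          { small    = ≤-trans (<⇒≤ (*-cancelˡ-< ℓ _ _ (≤-<-trans (≤-trans (proj₂ tight) (p⊆q⇒∣p∣≤∣q∣ (proj₁ tight))) ∣Y∣<))) small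
          ; disjoint = λ x∈C′ x∈∂ → let x∈U = proj₁ (∂⁻ Y U x∈∂) in
              [ Y#C (proj₁ tight x∈U) , (λ x∈Y─U → proj₂ (x∈p─q⁻ Y U x∈Y─U) x∈U) ]′ (x∈p∪q⁻ C (Y ─ U) x∈C′)
          ; closed   = λ x∈C′ x~y y∉∂ → step (x∈p∪q⁻ C (Y ─ U) x∈C′) x~y y∉∂
          ; majority = majority-⊆ {C} {C ∪ (Y ─ U)} (p⊆p∪q _) majority }
          where
          step : ∀ {x y} → x ∈ C ⊎ x ∈ Y ─ U → x ~ y → y ∉ ∂ Y U → y ∈ C ∪ (Y ─ U)
          step {x} {y} x∈ x~y y∉∂ with y ∈? C
          ... | yes y∈C = p⊆p∪q _ y∈C
          step {x} {y} (inj₁ x∈C) x~y y∉∂ | no y∉C with y ∈? S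
          ... | no  y∉S = contradiction (closed x∈C x~y y∉S) y∉C
          ... | yes y∈S = q⊆p∪q C _ (x∈p∧x∉q⇒x∈p─q (roots y∈S y∉C) λ y∈U → y∉∂ (∂⁺ Y U (y∈U , inj₁ y∈S)))
          step {x} {y} (inj₂ x∈Y─U) x~y y∉∂ | no y∉C with x∈p─q⁻ Y U x∈Y─U
          ... | x∈Y , x∉U = q⊆p∪q C _ (x∈p∧x∉q⇒x∈p─q (fence x∈Y x∉U x~y y∉C)
                              λ y∈U → y∉∂ (∂⁺ Y U (y∈U , inj₂ (x , x∈Y , x∉U , ~-sym x~y))))

        ℓ∣S∣≤∣Y∣ : ℓ * ∣ S ∣ ≤ ∣ Y ∣
        ℓ∣S∣≤∣Y∣ with ℓ * ∣ S ∣ ≤? ∣ Y ∣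
        ... | yes p = p
        ... | no ¬p = push (pushed-side (≰⇒> ¬p))

        module _ (∣S∣≤4s : ∣ S ∣ ≤ 4 * s) {Z : Subset n} (∣Z∣≤s : ∣ Z ∣ ≤ s) (halves : HalvesAfter (C ∪ Y) Z)
                 {D₀ : Subset n} (conn₀ : Conn D₀) (D₀#S∪Z : Disjoint D₀ (S ∪ (Z ∩ C)))
                 (closed₀ : Closed (S ∪ (Z ∩ C)) D₀) (majority₀ : Majority D₀) where

          D₀⊆C : D₀ ⊆ C
          D₀⊆C = stays closed conn₀ (λ x∈D₀ x∈S → D₀#S∪Z x∈D₀ (p⊆p∪q _ x∈S)) (majorities-meet majority₀ majority)

          D₀⊆H─Z : D₀ ⊆ (C ∪ Y) ─ Z
          D₀⊆H─Z x∈D₀ = x∈p∧x∉q⇒x∈p─q (p⊆p∪q Y (D₀⊆C x∈D₀))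
                          λ x∈Z → D₀#S∪Z x∈D₀ (q⊆p∪q S _ (x∈p∩q⁺ (x∈Z , D₀⊆C x∈D₀)))

          -- Besides `Z ∩ C`, only these vertices of `S` are needed to cut off `D₀`. The remaining
          -- ones occur on opposite sides of `cut-inside` and `cut-outside` and cancel.
          Attached : Pred (Fin n) _
          Attached y = y ∈ S × ∃[ x ] x ∈ D₀ × x ~ y

          attached? : Decidable Attached
          attached? y = y ∈? S ×-dec Finₚ.any? λ x → x ∈? D₀ ×-dec (x ~? y)

          S₀ : Subset n
          S₀ = ⟪ attached? ⟫

          S₀⊆S : S₀ ⊆ S
          S₀⊆S = proj₁ ∘ ∈⟪⟫⁻ attached?

          side₀ : Side (S₀ ∪ (Z ∩ C)) D₀
          side₀ = record
            { small    = begin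
                ∣ S₀ ∪ (Z ∩ C) ∣    ≤⟨ ∣p∪q∣≤∣p∣+∣q∣ S₀ (Z ∩ C) ⟩
                ∣ S₀ ∣ + ∣ Z ∩ C ∣  ≤⟨ +-mono-≤ (≤-trans (p⊆q⇒∣p∣≤∣q∣ S₀⊆S) ∣S∣≤4s) (≤-trans (∣p∩q∣≤∣p∣ Z C) ∣Z∣≤s) ⟩
                4 * s + s           ≡⟨ +-comm (4 * s) s ⟩
                5 * s               ∎
            ; disjoint = λ x∈D₀ x∈ → D₀#S∪Z x∈D₀ ([ (λ x∈S₀ → p⊆p∪q _ (S₀⊆S x∈S₀)) , q⊆p∪q S _ ]′ (x∈p∪q⁻ S₀ _ x∈))
            ; closed   = λ {x} {y} x∈D₀ x~y y∉ → closed₀ x∈D₀ x~y λ y∈ → y∉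
                ([ (λ y∈S → p⊆p∪q _ (∈⟪⟫⁺ attached? (y∈S , x , x∈D₀ , x~y))) , q⊆p∪q S₀ _ ]′ (x∈p∪q⁻ S _ y∈))
            ; majority = majority₀ }
            where open ≤-Reasoning

          cut-inside : ∣ C ∣ + ℓ * (∣ S₀ ∣ + ∣ S ─ S₀ ∣) ≤ ∣ D₀ ∣ + ℓ * (∣ S₀ ∣ + ∣ Z ∩ C ∣)
          cut-inside = begin
            ∣ C ∣ + ℓ * (∣ S₀ ∣ + ∣ S ─ S₀ ∣)       ≤⟨ +-monoʳ-≤ ∣ C ∣ (*-monoʳ-≤ ℓ (+-monoˡ-≤ ∣ S ─ S₀ ∣ (p⊆q⇒∣p∣≤∣q∣ λ x∈ → x∈p∩q⁺ (S₀⊆S x∈ , x∈)))) ⟩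
            ∣ C ∣ + ℓ * (∣ S ∩ S₀ ∣ + ∣ S ─ S₀ ∣)   ≡⟨ cong (λ k → ∣ C ∣ + ℓ * k) (∣p∩q∣+∣p─q∣ S S₀) ⟩
            ∣ C ∣ + ℓ * ∣ S ∣                       ≤⟨ minimal side₀ ⟩
            ∣ D₀ ∣ + ℓ * ∣ S₀ ∪ (Z ∩ C) ∣           ≤⟨ +-monoʳ-≤ ∣ D₀ ∣ (*-monoʳ-≤ ℓ (∣p∪q∣≤∣p∣+∣q∣ S₀ (Z ∩ C))) ⟩
            ∣ D₀ ∣ + ℓ * (∣ S₀ ∣ + ∣ Z ∩ C ∣)       ∎
            where open ≤-Reasoning

          module _ {D : Subset n} (D₀⊆D : D₀ ⊆ D) (D-max : MaximalConn ((C ∪ Y) ─ Z) D) where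

            -- A vertex of `Y` outside `Z` and `D` has no neighbour in the component `D`. On the
            -- boundary of `Y ─ D` it must therefore lie in `S`, and not in `S₀`, whose vertices
            -- have neighbours in `D₀`.
            ∂⊆ : ∂ Y (Y ─ D) ⊆ (Z ─ C) ∪ (S ─ S₀)
            ∂⊆ {u} u∈∂ with ∂⁻ Y (Y ─ D) u∈∂
            ... | u∈Y─D , _ with u ∈? Z | x∈p─q⁻ Y D u∈Y─D
            ...   | yes u∈Z | u∈Y , _ = p⊆p∪q _ (x∈p∧x∉q⇒x∈p─q u∈Z (Y#C u∈Y))
            ∂⊆ {u} u∈∂ | _ , inj₁ u∈S | no u∉Z | u∈Y , u∉D =
              q⊆p∪q (Z ─ C) _ (x∈p∧x∉q⇒x∈p─q u∈S λ u∈S₀ →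
                let _ , x , x∈D₀ , x~u = ∈⟪⟫⁻ attached? u∈S₀
                in u∉D (absorb D-max (D₀⊆D x∈D₀) x~u (x∈p∧x∉q⇒x∈p─q (q⊆p∪q C Y u∈Y) u∉Z)))
            ∂⊆ {u} u∈∂ | _ , inj₂ (v , v∈Y , v∉Y─D , u~v) | no u∉Z | u∈Y , u∉D with v ∈? D
            ... | yes v∈D = contradiction (absorb D-max v∈D (~-sym u~v) (x∈p∧x∉q⇒x∈p─q (q⊆p∪q C Y u∈Y) u∉Z)) u∉D
            ... | no  v∉D = contradiction (x∈p∧x∉q⇒x∈p─q v∈Y v∉D) v∉Y─D

            cut-outside : ∣ Y ─ D ∣ ≤ ℓ * (∣ Z ─ C ∣ + ∣ S ─ S₀ ∣)
            cut-outside = ≤-trans (robust (Y ─ D) (p─q⊆p Y D))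
              (*-monoʳ-≤ ℓ (≤-trans (p⊆q⇒∣p∣≤∣q∣ ∂⊆) (∣p∪q∣≤∣p∣+∣q∣ (Z ─ C) (S ─ S₀))))

            cover : ∣ D₀ ∣ + ∣ Y ∣ ≤ ∣ D ∣ + ∣ Y ─ D ∣
            cover = begin
              ∣ D₀ ∣ + ∣ Y ∣    ≡⟨ disjoint⇒∣p∪q∣ D₀ Y (λ x∈D₀ x∈Y → Y#C x∈Y (D₀⊆C x∈D₀)) ⟨
              ∣ D₀ ∪ Y ∣        ≤⟨ p⊆q⇒∣p∣≤∣q∣ covered ⟩
              ∣ D ∪ (Y ─ D) ∣   ≤⟨ ∣p∪q∣≤∣p∣+∣q∣ D (Y ─ D) ⟩
              ∣ D ∣ + ∣ Y ─ D ∣ ∎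
              where
              open ≤-Reasoning
              covered : D₀ ∪ Y ⊆ D ∪ (Y ─ D)
              covered {x} x∈ with x ∈? D | x∈p∪q⁻ D₀ Y x∈
              ... | yes x∈D | _ = p⊆p∪q _ x∈D
              ... | no  x∉D | inj₁ x∈D₀ = contradiction (D₀⊆D x∈D₀) x∉D
              ... | no  x∉D | inj₂ x∈Y  = q⊆p∪q D _ (x∈p∧x∉q⇒x∈p─q x∈Y x∉D)

            Φ≤ : Φ ℓ (S , C) ≤ 2 * (ℓ * s)
            Φ≤ = ≤-trans (+-monoʳ-≤ ∣ C ∣ ℓ∣S∣≤∣Y∣)
              (accounting {c = ∣ C ∣} {ℓ} {∣ S₀ ∣} {∣ S ─ S₀ ∣} {∣ D₀ ∣} {∣ Z ∩ C ∣} {∣ Z ─ C ∣} {∣ Y ∣} {∣ D ∣} {∣ Y ─ D ∣}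
                cut-inside cut-outside cover (≤-trans (≤-reflexive (∣p∩q∣+∣p─q∣ Z C)) ∣Z∣≤s)
                (≤-trans (halves D (λ x∈D → proj₁ (inH x∈D)) (λ x∈D → proj₂ (inH x∈D)) (proj₁ (proj₂ D-max)))
                         (∣p∪q∣≤∣p∣+∣q∣ C Y)))
              where
              inH : ∀ {x} → x ∈ D → x ∈ C ∪ Y × x ∉ Z
              inH x∈D = x∈p─q⁻ (C ∪ Y) Z (proj₁ D-max x∈D)

      minimum-bounded : ∣ S ∣ ≤ 4 * s → ¬ (2 * (ℓ * s) < Φ ℓ (S , C))
      minimum-bounded ∣S∣≤4s large =
        saturate C λ sat → let open Saturated sat in
        separable (C ∪ Y) λ { (Z , ∣Z∣≤s , halves) →
        -- The bound 4s leaves room for the at most s vertices of `Z` within the 5s that `big`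
        -- allows.
        big (S ∪ (Z ∩ C)) (≤-trans (∣p∪q∣≤∣p∣+∣q∣ S (Z ∩ C))
                            (≤-trans (+-mono-≤ ∣S∣≤4s (≤-trans (∣p∩q∣≤∣p∣ Z C) ∣Z∣≤s)) (≤-reflexive (+-comm (4 * s) s))))
        λ { (D₀ , conn₀ , disj₀ , closed₀ , maj₀) →
        grow (D₀⊆H─Z sat ∣S∣≤4s ∣Z∣≤s halves conn₀ disj₀ closed₀ maj₀) conn₀ λ { (D , D₀⊆D , D-max) →
        <-irrefl refl (<-≤-trans large (Φ≤ sat ∣S∣≤4s ∣Z∣≤s halves conn₀ disj₀ closed₀ maj₀ D₀⊆D D-max)) } } }

    Φ>2 : ∀ m {S C} → Side S C → 2 * (suc m * s) < Φ (suc m) (S , C)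
    Φ>4 : ∀ m {S C} → Side S C → 4 * (suc m * s) < Φ (suc m) (S , C)

    Φ>2 zero {S} {C} side = ≰⇒> λ Φ≤ →
      let open ≤-Reasoning
          ∣S∪C∣≤2s : ∣ S ∪ C ∣ ≤ 2 * s
          ∣S∪C∣≤2s = begin
            ∣ S ∪ C ∣            ≤⟨ ∣p∪q∣≤∣p∣+∣q∣ S C ⟩
            ∣ S ∣ + ∣ C ∣        ≡⟨ +-comm ∣ S ∣ ∣ C ∣ ⟩
            ∣ C ∣ + ∣ S ∣        ≡⟨ cong (∣ C ∣ +_) (*-identityˡ ∣ S ∣) ⟨
            ∣ C ∣ + 1 * ∣ S ∣    ≤⟨ Φ≤ ⟩
            2 * (1 * s)          ≡⟨ cong (2 *_) (*-identityˡ s) ⟩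
            2 * s                ∎
      -- A majority found after deleting `S ∪ C` avoids `C`, although any two majorities meet.
      in big (S ∪ C) (≤-trans ∣S∪C∣≤2s (*-monoˡ-≤ s {2} {5} (s≤s (s≤s z≤n)))) λ { (D , _ , D#S∪C , _ , mD) →
         let x , x∈ = majorities-meet mD (Side.majority side)
             x∈D , x∈C = x∈p∩q⁻ D C x∈
         in D#S∪C x∈D (q⊆p∪q S C x∈C) }
    Φ>2 (suc m) {S} {C} side = begin-strict
      -- With ℓ = `suc m` ≥ 1 one has ℓ + 1 ≤ 2ℓ, so the bound 4ℓs is enough for the next weight.
      2 * (suc (suc m) * s)     ≤⟨ *-monoʳ-≤ 2 (*-monoˡ-≤ s 2+m≤) ⟩
      2 * (2 * suc m * s)       ≡⟨ solve 2 (λ m s → con 2 :* (con 2 :* m :* s) := con 4 :* (m :* s)) refl (suc m) s ⟩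
      4 * (suc m * s)           <⟨ Φ>4 m side ⟩
      ∣ C ∣ + suc m * ∣ S ∣     ≤⟨ +-monoʳ-≤ ∣ C ∣ (*-monoˡ-≤ ∣ S ∣ (n≤1+n (suc m))) ⟩
      ∣ C ∣ + suc (suc m) * ∣ S ∣ ∎
      where
      open ≤-Reasoning
      open +-*-Solver
      2+m≤ : suc (suc m) ≤ 2 * suc m
      2+m≤ = ≤-trans (+-monoˡ-≤ (suc m) (s≤s (z≤n {m}))) (≤-reflexive (cong (suc m +_) (sym (+-identityʳ (suc m)))))

    Φ>4 m side = ≰⇒> λ Φ≤ →
      ¬¬-argmin {P = uncurry Side} (Φ (suc m)) side λ { ((S , C) , side′ , least) →
        let open ≤-Reasoning in
        -- If some side had Φ at most 4ℓs, so would the minimizer, and dividing ℓ|S| ≤ 4ℓs by ℓ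
        -- gives the required bound on `S`.
        Minimizer.minimum-bounded (suc m) (s≤s z≤n) side′ least
          (*-cancelˡ-≤ (suc m) (begin
            suc m * ∣ S ∣           ≤⟨ m≤n+m _ ∣ C ∣ ⟩
            Φ (suc m) (S , C)       ≤⟨ ≤-trans (least side) Φ≤ ⟩
            4 * (suc m * s)         ≡⟨ solve₄ (suc m) ⟩
            suc m * (4 * s)         ∎))
          (Φ>2 m side′) }
      where
      open +-*-Solver
      solve₄ : ∀ m → 4 * (m * s) ≡ m * (4 * s)
      solve₄ m = solve 2 (λ m s → con 4 :* (m :* s) := m :* (con 4 :* s)) refl m s

    -- Deleting nothing from a one-vertex graph leaves a connected set with more than half of the
    -- vertices.
    s-positive : Fin n → ¬ (s ≡ 0)
    s-positive v s≡0 = separable ⁅ v ⁆ λ { (Z , ∣Z∣≤s , halves) →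
      contradiction (subst₂ _≤_ (cong (2 *_) (∣⁅x⁆∣≡1 v)) (∣⁅x⁆∣≡1 v)
        (halves ⁅ v ⁆ (λ x∈ → x∈) (λ {x} _ x∈Z → contradiction (≤-trans (x∈p⇒1≤ x∈Z) (≤-trans ∣Z∣≤s (≤-reflexive s≡0))) λ ()) (conn-⁅⁆ v)))
        λ { (s≤s ()) } }
      where
      x∈p⇒1≤ : ∀ {x} {p : Subset n} → x ∈ p → 1 ≤ ∣ p ∣
      x∈p⇒1≤ {x} x∈p = ≤-trans (≤-reflexive (sym (∣⁅x⁆∣≡1 x))) (p⊆q⇒∣p∣≤∣q∣ λ y∈ → subst (_∈ _) (sym (x∈⁅y⁆⇒x≡y x y∈)) x∈p)

    no-obstruction : ⊥
    no-obstruction = big Subset.⊥ (≤-trans (≤-reflexive (∣⊥∣≡0 n)) z≤n) λ { (D , _ , _ , _ , mD) →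
      -- A majority is nonempty; this supplies the vertex for `s-positive`.
      let x , _ = majorities-meet {D} {D} mD mD
          whole : Side Subset.⊥ Subset.⊤
          whole = record { small = ≤-trans (≤-reflexive (∣⊥∣≡0 n)) z≤n ; disjoint = λ _ → ∉⊥
                         ; closed = λ _ _ _ → ∈⊤ ; majority = majority-⊆ {D} (λ _ → ∈⊤) mD }
          open ≤-Reasoning
      -- With empty separator Φ is n for every ℓ, while ℓ = n + 1 and s ≥ 1 bring the strict lower
      -- bound 2ℓs to at least n.
      in <-irrefl refl (begin-strict
        n                                         ≤⟨ m≤n*m n s {{>-nonZero (n≢0⇒n>0 (s-positive x))}} ⟩
        s * n                                     ≡⟨ *-comm s n ⟩
        n * s                                     ≤⟨ m≤n+m (n * s) s ⟩
        suc n * s                                 ≤⟨ m≤m+n _ _ ⟩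
        2 * (suc n * s)                           <⟨ Φ>2 n whole ⟩
        ∣ Subset.⊤ {n} ∣ + suc n * ∣ Subset.⊥ {n} ∣ ≡⟨ cong₂ (λ a b → a + suc n * b) (∣⊤∣≡n n) (∣⊥∣≡0 n) ⟩
        n + suc n * 0                             ≡⟨ trans (cong (n +_) (*-zeroʳ n)) (+-identityʳ n) ⟩
        n                                         ∎) }

  balanced-separator : ∀ {s} → Separable s → ∀ W → ¬ ¬ ∃ (BalancedSeparator (5 * s) W)
  balanced-separator separable W none = no-obstruction separable W none

-- Induced subgraphs

enum : (B : Subset m) → Fin ∣ B ∣ → Fin m
enum (inside ∷ B)  Fin.zero    = Fin.zero
enum (inside ∷ B)  (Fin.suc i) = Fin.suc (enum B i)
enum (outside ∷ B) i           = Fin.suc (enum B i)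

enum-injective : (B : Subset m) → ∀ {i j} → enum B i ≡ enum B j → i ≡ j
enum-injective (inside ∷ B)  {Fin.zero}  {Fin.zero}  _  = refl
enum-injective (inside ∷ B)  {Fin.suc i} {Fin.suc j} eq = cong Fin.suc (enum-injective B (Finₚ.suc-injective eq))
enum-injective (outside ∷ B) eq = enum-injective B (Finₚ.suc-injective eq)

enum-surjective : (B : Subset m) → ∀ {x} → x ∈ B → ∃[ i ] enum B i ≡ x
enum-surjective (inside ∷ B)  here = Fin.zero , refl
enum-surjective (inside ∷ B)  (there x∈B) = let i , eq = enum-surjective B x∈B in Fin.suc i , cong Fin.suc eq
enum-surjective (outside ∷ B) (there x∈B) = let i , eq = enum-surjective B x∈B in i , cong Fin.suc eq

restrict : (B : Subset m) → Subset m → Subset ∣ B ∣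
restrict []          []      = []
restrict (inside ∷ B)  (d ∷ D) = d ∷ restrict B D
restrict (outside ∷ B) (d ∷ D) = restrict B D

∈-restrict⁻ : (B D : Subset m) → ∀ {i} → i ∈ restrict B D → enum B i ∈ D
∈-restrict⁻ (inside ∷ B)  (_ ∷ D) here       = here
∈-restrict⁻ (inside ∷ B)  (_ ∷ D) (there i∈) = there (∈-restrict⁻ B D i∈)
∈-restrict⁻ (outside ∷ B) (_ ∷ D) i∈         = there (∈-restrict⁻ B D i∈)

∈-restrict⁺ : (B D : Subset m) → ∀ {i} → enum B i ∈ D → i ∈ restrict B D
∈-restrict⁺ (inside ∷ B)  (_ ∷ D) {Fin.zero}  here       = here
∈-restrict⁺ (inside ∷ B)  (_ ∷ D) {Fin.suc i} (there i∈) = there (∈-restrict⁺ B D i∈)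
∈-restrict⁺ (outside ∷ B) (_ ∷ D) (there i∈)             = ∈-restrict⁺ B D i∈

∣restrict∣ : (B D : Subset m) → D ⊆ B → ∣ restrict B D ∣ ≡ ∣ D ∣
∣restrict∣ []          []          D⊆B = refl
∣restrict∣ (inside ∷ B)  (inside ∷ D)  D⊆B = cong suc (∣restrict∣ B D (drop-∷-⊆ D⊆B))
∣restrict∣ (inside ∷ B)  (outside ∷ D) D⊆B = ∣restrict∣ B D (drop-∷-⊆ D⊆B)
∣restrict∣ (outside ∷ B) (inside ∷ D)  D⊆B with () ← D⊆B here
∣restrict∣ (outside ∷ B) (outside ∷ D) D⊆B = ∣restrict∣ B D (drop-∷-⊆ D⊆B)

expand : (B : Subset m) → Subset ∣ B ∣ → Subset m
expand []          []      = []
expand (inside ∷ B)  (z ∷ Z) = z ∷ expand B Z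
expand (outside ∷ B) Z       = outside ∷ expand B Z

∈-expand⁺ : (B : Subset m) (Z : Subset ∣ B ∣) → ∀ {i} → i ∈ Z → enum B i ∈ expand B Z
∈-expand⁺ (inside ∷ B)  (_ ∷ Z) here       = here
∈-expand⁺ (inside ∷ B)  (_ ∷ Z) (there i∈) = there (∈-expand⁺ B Z i∈)
∈-expand⁺ (outside ∷ B) Z       i∈         = there (∈-expand⁺ B Z i∈)

∣expand∣ : (B : Subset m) (Z : Subset ∣ B ∣) → ∣ expand B Z ∣ ≡ ∣ Z ∣
∣expand∣ []          []          = refl
∣expand∣ (inside ∷ B)  (inside ∷ Z)  = cong suc (∣expand∣ B Z)
∣expand∣ (inside ∷ B)  (outside ∷ Z) = ∣expand∣ B Z
∣expand∣ (outside ∷ B) Z           = ∣expand∣ B Z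

maximal⇒component : ∀ Γ {S C} → Connectivity.MaximalConn Γ (∁ S) C → Nonempty C → IsComponent Γ S C
maximal⇒component Γ (C⊆∁S , conn , max) ne = record
  { nonempty  = ne
  ; avoids    = x∈∁p⇒x∉p ∘ C⊆∁S
  ; connected = conn
  ; maximal   = λ D C⊆D D#S connD → max D C⊆D (x∉p⇒x∈∁p ∘ D#S) connD }

module _ (Γ : FiniteGraph) (B : Subset (order Γ)) where
  open FiniteGraph Γ using (_~_; _~?_; ~-sym; ~-irrefl)
  open Connectivity using (Conn; Walk; widen; grow)
  open Separation Γ using (HalvesAfter)

  induced : FiniteGraph
  induced = record
    { order    = ∣ B ∣
    ; _~_      = λ i j → enum B i ~ enum B j
    ; _~?_     = λ i j → enum B i ~? enum B j
    ; ~-sym    = ~-sym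
    ; ~-irrefl = ~-irrefl }

  induced-⊑ : {X : Graph v e} → Γ ⊑ X → induced ⊑ X
  induced-⊑ Γ⊑X = record
    { embed = embed ∘ enum B ; injective = enum-injective B ∘ injective ; edge = edge }
    where open _⊑_ Γ⊑X

  induced-walk : ∀ {D a b} → D ⊆ B → Walk Γ D a b → ∀ {i j} → enum B i ≡ proj₁ a → enum B j ≡ proj₁ b →
                 ∀ p q → Walk induced (restrict B D) (i , p) (j , q)
  induced-walk {D} D⊆B ε eqᵢ eqⱼ p q with enum-injective B (trans eqᵢ (sym eqⱼ))
  ... | refl = widen induced {D = restrict B D} {x = _ , p} (λ r → r) ε p q
  induced-walk {D} D⊆B (_◅_ {j = y , y∈D} a~y w) refl eqⱼ p q with enum-surjective B (D⊆B y∈D)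
  ... | k , refl = _◅_ {j = k , ∈-restrict⁺ B D y∈D} a~y (induced-walk D⊆B w refl eqⱼ _ q)

  -- `IsCutset` bounds components only, so `D` is carried over to the induced graph and enlarged
  -- there to a component.
  cutset⇒halves : ∀ {Z} → IsCutset induced Z → HalvesAfter B (expand B Z)
  cutset⇒halves {Z} cutset D D⊆B D#Z conn = decidable-stable (_ ≤? _) λ ¬small →
    grow induced {B = ∁ Z} {D = restrict B D}
      (λ i∈ → x∉p⇒x∈∁p λ i∈Z → D#Z (∈-restrict⁻ B D i∈) (∈-expand⁺ B Z i∈Z))
      (λ (i , p) (j , q) → induced-walk D⊆B (conn (_ , ∈-restrict⁻ B D p) (_ , ∈-restrict⁻ B D q)) refl refl p q)
      λ { (C , D⊆C , C-max) → ¬small (≤-trans (*-monoʳ-≤ 2 (∣D∣≤∣C∣ D⊆C)) (small C C-max)) }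
    where
    ∣D∣≤∣C∣ : ∀ {C} → restrict B D ⊆ C → ∣ D ∣ ≤ ∣ C ∣
    ∣D∣≤∣C∣ D⊆C = ≤-trans (≤-reflexive (sym (∣restrict∣ B D D⊆B))) (p⊆q⇒∣p∣≤∣q∣ D⊆C)
    small : ∀ C → Connectivity.MaximalConn induced (∁ Z) C → 2 * ∣ C ∣ ≤ ∣ B ∣
    small C C-max with nonempty? C
    ... | yes ne   = cutset C (maximal⇒component induced C-max ne)
    ... | no empty = ≤-trans (≤-reflexive (cong (2 *_) (trans (cong ∣_∣ (Empty-unique empty)) (∣⊥∣≡0 ∣ B ∣)))) z≤n

-- An induced subgraph of `Γ` is again a subgraph of `X` on at most r vertices, so its cutsize is
-- among the numbers that s bounds.
sep⇒separable : ∀ {X : Graph v e} {r s Γ} → IsSep X r s → Γ ⊑ X → order Γ ≤ r → Separation.Separable Γ s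
sep⇒separable {Γ = Γ} (_ , upper) Γ⊑X Γ≤r B none =
  cut-exists (induced Γ B) λ { (_ , isCut@((Z , cutset , refl) , _)) →
    none (expand B Z ,
          ≤-trans (≤-reflexive (∣expand∣ B Z))
                  (upper (induced Γ B , induced-⊑ Γ B Γ⊑X , ≤-trans (∣p∣≤n B) Γ≤r , isCut)) ,
          cutset⇒halves Γ B cutset) }

-- Trees

module _ {G : Graph v e} (cycle : Cycle G) where
  open Graph G
  open Cycle cycle

  cycle-neighbours : ∀ i → ∃[ j ] ∃[ j′ ] j ≢ j′ × at j ~ at i × at j′ ~ at i
  cycle-neighbours i with view i
  cycle-neighbours .(fromℕ (2 + k)) | ‵fromℕ =
    inject₁ (fromℕ (1 + k)) , Fin.zero , (λ ()) , step (fromℕ (1 + k)) , ~-sym close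
  cycle-neighbours .(Fin.zero) | ‵inject₁ Fin.zero =
    Fin.suc Fin.zero , fromℕ (2 + k) , (λ ()) , ~-sym (step Fin.zero) , close
  cycle-neighbours .(inject₁ (Fin.suc i)) | ‵inject₁ (Fin.suc i) =
    Fin.suc (Fin.suc i) , inject₁ (inject₁ i) , distinct , ~-sym (step (Fin.suc i)) , step (inject₁ i)
    where
    distinct : Fin.suc (Fin.suc i) ≢ inject₁ (inject₁ i)
    distinct eq = m≢1+n+m (toℕ i) {1} (sym (trans (cong toℕ eq) (trans (Finₚ.toℕ-inject₁ (inject₁ i)) (Finₚ.toℕ-inject₁ i))))

  -- The deepest vertex of a cycle would have two distinct parents.
  parented⇒⊥ : (depth : Vertex → ℕ) (_⋖_ : Vertex → Vertex → Set) →
               (∀ {x y} → x ~ y → x ⋖ y ⊎ y ⋖ x) → (∀ {x y} → x ⋖ y → depth x < depth y) →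
               (∀ {x y z} → x ⋖ z → y ⋖ z → x ≡ y) → ⊥
  parented⇒⊥ depth _⋖_ orient ⋖⇒< unique =
    ¬¬-argmin {P = λ _ → Fin (3 + k)} (λ i → B ∸ depth (at i)) {Fin.zero} Fin.zero λ { (i , _ , least) →
      let j , j′ , j≢j′ , j~i , j′~i = cycle-neighbours i
          parent : ∀ j → at j ~ at i → at j ⋖ at i
          parent j j~i = [ (λ p → p) , (λ p → contradiction (⋖⇒< p) (≤⇒≯ (∸-cancelʳ-≤ (bounded j) (least j)))) ]′ (orient j~i)
      in j≢j′ (injective (unique (parent j j~i) (parent j′ j′~i))) }
    where
    sum : ∀ m → (Fin m → ℕ) → ℕ
    sum zero    f = 0
    sum (suc m) f = f Fin.zero + sum m (f ∘ Fin.suc)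
    f≤sum : ∀ m f i → f i ≤ sum m f
    f≤sum (suc m) f Fin.zero    = m≤m+n _ _
    f≤sum (suc m) f (Fin.suc i) = ≤-trans (f≤sum m (f ∘ Fin.suc) i) (m≤n+m _ _)
    -- Any common bound on the depths serves to turn the search for a deepest vertex into a
    -- minimization.
    B = sum (3 + k) (depth ∘ at)
    bounded : ∀ i → depth (at i) ≤ B
    bounded = f≤sum (3 + k) (depth ∘ at)

module Address (A : Set) where

  -- The parent relation on addresses read from the root: a child has one more letter at the far
  -- end. Prefixing a letter thus embeds the whole tree as the branch at a child of the root, and
  -- decompositions can be glued without building a new tree.
  data _⋖_ : List A → List A → Set where
    base : ∀ {a} → [] ⋖ (a ∷ [])
    step : ∀ {a xs ys} → xs ⋖ ys → (a ∷ xs) ⋖ (a ∷ ys)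

  ⋖⇒< : ∀ {xs ys} → xs ⋖ ys → length xs < length ys
  ⋖⇒< base     = s≤s z≤n
  ⋖⇒< (step p) = s≤s (⋖⇒< p)

  ⋖-unique : ∀ {xs ys zs} → xs ⋖ zs → ys ⋖ zs → xs ≡ ys
  ⋖-unique base     base     = refl
  ⋖-unique (step p) (step q) = cong (_ ∷_) (⋖-unique p q)

  tree : Graph 0ℓ 0ℓ
  tree = record
    { Vertex   = List A
    ; _~_      = λ xs ys → xs ⋖ ys ⊎ ys ⋖ xs
    ; ~-sym    = swap
    ; ~-irrefl = λ { (inj₁ p) → <-irrefl refl (⋖⇒< p) ; (inj₂ p) → <-irrefl refl (⋖⇒< p) } }

  open Graph tree using (_~_; ~-sym)

  descend : ∀ {a xs ys} → xs ~ ys → (a ∷ xs) ~ (a ∷ ys)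
  descend = Sum.map step step

  fromRoot : ∀ xs → Star _~_ [] xs
  fromRoot []       = ε
  fromRoot (x ∷ xs) = inj₁ base ◅ gmap (x ∷_) descend (fromRoot xs)

  isTree : IsTree tree
  isTree = record
    { node      = []
    ; connected = λ xs ys → reverse ~-sym (fromRoot xs) ◅◅ fromRoot ys
    ; acyclic   = λ c → parented⇒⊥ c length _⋖_ (λ p → p) ⋖⇒< ⋖-unique }

-- The recursive tree-decomposition

module Decompose (Γ : FiniteGraph) where
  open FiniteGraph Γ using (_~_; _~?_; ~-sym) renaming (order to n)
  open Connectivity Γ
  open Separation Γ
  open Address (Subset n)

  Rim : Subset n → Pred (Fin n) _
  Rim P y = y ∉ P × ∃[ x ] x ∈ P × x ~ y

  rim? : ∀ P → Decidable (Rim P)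
  rim? P y = ¬? (y ∈? P) ×-dec Finₚ.any? λ x → x ∈? P ×-dec (x ~? y)

  N : Subset n → Subset n
  N P = ⟪ rim? P ⟫

  Bags : Set
  Bags = List (Subset n) → Subset n

  -- The tree is always the tree of addresses, so only the bags vary. Having the whole rim in the
  -- root bag is what keeps the bags of a vertex connected when the piece is hung below a parent.
  record Decomposes (k : ℕ) (P : Subset n) (bag : Bags) : Set where
    field
      vertices  : ∀ {x} → x ∈ P → ∃[ g ] x ∈ bag g
      edges     : ∀ {x y} → x ∈ P → x ~ y → ∃[ g ] x ∈ bag g × y ∈ bag g
      rim       : ∀ {y} → Rim P y → y ∈ bag []
      within    : ∀ {y} g → y ∈ bag g → y ∈ P ⊎ Rim P y
      small     : ∀ g → ∣ bag g ∣ ≤ k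
      connected : ∀ x → Connected (full tree λ g → x ∈ bag g)

  Component : Subset n → Subset n → Set
  Component B Q = MaximalConn B Q × Nonempty Q

  component-unique : ∀ {B Q Q′ x} → MaximalConn B Q → MaximalConn B Q′ → x ∈ Q → x ∈ Q′ → Q ≡ Q′
  component-unique {B} {Q} {Q′} (Q⊆B , conn , max) (Q′⊆B , conn′ , max′) x∈Q x∈Q′ = ⊆-antisym
    (λ y∈ → max′ (Q ∪ Q′) (q⊆p∪q Q Q′) ∪⊆B conn-Q∪Q′ (p⊆p∪q Q′ y∈))
    (λ y∈ → max (Q ∪ Q′) (p⊆p∪q Q′) ∪⊆B conn-Q∪Q′ (q⊆p∪q Q Q′ y∈))
    where
    ∪⊆B : Q ∪ Q′ ⊆ B
    ∪⊆B y∈ = [ Q⊆B , Q′⊆B ]′ (x∈p∪q⁻ Q Q′ y∈)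
    conn-Q∪Q′ : Conn (Q ∪ Q′)
    conn-Q∪Q′ = conn-∪ conn conn′ x∈Q x∈Q′ (inj₁ refl)

  -- `R` becomes the root bag. There is a branch for every subset `Q`; those of components of
  -- `P ─ R` carry their decompositions, all others empty bags.
  module Glue {k : ℕ} {P R : Subset n} (N⊆R : ∀ {y} → Rim P y → y ∈ R)
              (R⊆ : ∀ {y} → y ∈ R → y ∈ P ⊎ Rim P y) (∣R∣≤k : ∣ R ∣ ≤ k)
              (component : ∀ D → D ⊆ P ─ R → Conn D → ∃[ Q ] D ⊆ Q × MaximalConn (P ─ R) Q)
              (child : Subset n → Bags)
              (decomposed : ∀ Q → (Component (P ─ R) Q × Decomposes k Q (child Q)) ⊎
                                  (¬ Component (P ─ R) Q × ∀ g → child Q g ≡ Subset.⊥)) where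

    bag : Bags
    bag []      = R
    bag (Q ∷ g) = child Q g

    module _ {Q : Subset n} (comp : Component (P ─ R) Q) where
      maximal = proj₁ comp

      Q⊆P : Q ⊆ P
      Q⊆P = p─q⊆p P R ∘ proj₁ maximal

      Q∌R : ∀ {x} → x ∈ Q → x ∉ R
      Q∌R x∈Q = proj₂ (x∈p─q⁻ P R (proj₁ maximal x∈Q))

      rim⊆R : ∀ {y} → Rim Q y → y ∈ R
      rim⊆R {y} (y∉Q , x , x∈Q , x~y) with y ∈? P | y ∈? R
      ... | _       | yes y∈R = y∈R
      ... | yes y∈P | no y∉R = contradiction (absorb maximal x∈Q x~y (x∈p∧x∉q⇒x∈p─q y∈P y∉R)) y∉Q
      ... | no y∉P  | no y∉R = N⊆R (y∉P , x , Q⊆P x∈Q , x~y)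

      decomposes : Decomposes k Q (child Q)
      decomposes with decomposed Q
      ... | inj₁ (_ , dec) = dec
      ... | inj₂ (¬comp , _) = contradiction comp ¬comp

    occupied : ∀ {Q g x} → x ∈ child Q g → Component (P ─ R) Q
    occupied {Q} {g} x∈ with decomposed Q
    ... | inj₁ (comp , _) = comp
    ... | inj₂ (_ , empty) = contradiction (subst (_ ∈_) (empty g) x∈) ∉⊥

    home : ∀ {x} → x ∈ P → x ∉ R → ∃[ Q ] x ∈ Q × Component (P ─ R) Q
    home {x} x∈P x∉R =
      let Q , x⊆Q , max = component ⁅ x ⁆ (λ y∈ → subst (_∈ P ─ R) (sym (x∈⁅y⁆⇒x≡y x y∈)) (x∈p∧x∉q⇒x∈p─q x∈P x∉R)) (conn-⁅⁆ x)
      in Q , x⊆Q (x∈⁅x⁆ x) , max , x , x⊆Q (x∈⁅x⁆ x)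

    covers : ∀ {x} → x ∈ P → ∃[ g ] x ∈ bag g
    covers {x} x∈P with x ∈? R
    ... | yes x∈R = [] , x∈R
    ... | no  x∉R =
      let Q , x∈Q , comp = home x∈P x∉R
          g , x∈ = Decomposes.vertices (decomposes comp) x∈Q
      in Q ∷ g , x∈

    covers-edge : ∀ {x y} → x ∈ P → x ∉ R → x ~ y → ∃[ g ] x ∈ bag g × y ∈ bag g
    covers-edge x∈P x∉R x~y =
      let Q , x∈Q , comp = home x∈P x∉R
          g , xy∈ = Decomposes.edges (decomposes comp) x∈Q x~y
      in Q ∷ g , xy∈

    covers-edges : ∀ {x y} → x ∈ P → x ~ y → ∃[ g ] x ∈ bag g × y ∈ bag g
    covers-edges {x} {y} x∈P x~y with x ∈? R | y ∈? R | y ∈? P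
    ... | no x∉R  | _       | _       = covers-edge x∈P x∉R x~y
    ... | yes x∈R | yes y∈R | _       = [] , x∈R , y∈R
    ... | yes x∈R | no y∉R  | no y∉P  = contradiction (N⊆R (y∉P , x , x∈P , x~y)) y∉R
    ... | yes x∈R | no y∉R  | yes y∈P =
      let g , y∈ , x∈ = covers-edge y∈P y∉R (~-sym x~y) in g , x∈ , y∈

    bag⊆ : ∀ {y} g → y ∈ bag g → y ∈ P ⊎ Rim P y
    bag⊆ []      y∈R = R⊆ y∈R
    bag⊆ (Q ∷ g) y∈ with occupied {Q} {g} y∈
    ... | comp = [ inj₁ ∘ Q⊆P comp , R⊆ ∘ rim⊆R comp ]′ (Decomposes.within (decomposes comp) g y∈)

    bag-small : ∀ g → ∣ bag g ∣ ≤ k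
    bag-small []      = ∣R∣≤k
    bag-small (Q ∷ g) with decomposed Q
    ... | inj₁ (_ , dec)   = Decomposes.small dec g
    ... | inj₂ (_ , empty) = ≤-trans (≤-reflexive (trans (cong ∣_∣ (empty g)) (∣⊥∣≡0 n))) z≤n

    TreeWalk : ∀ x → ∃ (λ g → x ∈ bag g) → ∃ (λ g → x ∈ bag g) → Set
    TreeWalk x = Star (Graph._~_ (full tree λ g → x ∈ bag g))

    inChild : ∀ {Q g g′ x} → Component (P ─ R) Q → (x∈ : x ∈ child Q g) (x∈′ : x ∈ child Q g′) →
              TreeWalk x (Q ∷ g , x∈) (Q ∷ g′ , x∈′)
    inChild {Q} {x = x} comp x∈ x∈′ =
      gmap (λ (g , x∈) → Q ∷ g , x∈) descend (Decomposes.connected (decomposes comp) x (_ , x∈) (_ , x∈′))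

    toRoot : ∀ {x} g (x∈ : x ∈ bag g) (x∈R : x ∈ R) → TreeWalk x (g , x∈) ([] , x∈R)
    toRoot {x} []    x∈ x∈R = subst (λ p → TreeWalk x ([] , x∈) ([] , p)) (∈-irrelevant x∈ x∈R) ε
    toRoot (Q ∷ g) x∈ x∈R =
      let comp = occupied {Q} {g} x∈
          dec  = decomposes comp
          -- As `x` is in `R` it is not in `Q`; occurring in a bag of the child, it is on the rim of
          -- `Q` and so in the child's root bag.
          x∈Q[] = [ (λ x∈Q → contradiction x∈R (Q∌R comp x∈Q)) , Decomposes.rim dec ]′ (Decomposes.within dec g x∈)
      in inChild comp x∈ x∈Q[] ◅◅ (inj₂ base ◅ ε)

    inside-child : ∀ {x Q g} → x ∉ R → x ∈ child Q g → x ∈ Q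
    inside-child {x} {Q} {g} x∉R x∈ =
      let comp = occupied {Q} {g} x∈ in
      [ (λ x∈Q → x∈Q) , (λ r → contradiction (rim⊆R comp r) x∉R) ]′ (Decomposes.within (decomposes comp) g x∈)

    -- Bags with a vertex of `R` all connect to the root. Any other vertex lies in a single
    -- component, so its bags are in one branch.
    bag-connected : ∀ x → Connected (full tree λ g → x ∈ bag g)
    bag-connected x (g , x∈) (g′ , x∈′) with x ∈? R
    ... | yes x∈R = toRoot g x∈ x∈R ◅◅ reverse swap (toRoot g′ x∈′ x∈R)
    bag-connected x ([] , x∈) _ | no x∉R = contradiction x∈ x∉R
    bag-connected x (_ ∷ _ , _) ([] , x∈′) | no x∉R = contradiction x∈′ x∉R
    bag-connected x (Q ∷ g , x∈) (Q′ ∷ g′ , x∈′) | no x∉R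
      with component-unique (maximal (occupied {Q} {g} x∈)) (maximal (occupied {Q′} {g′} x∈′))
                            (inside-child {Q = Q} {g} x∉R x∈) (inside-child {Q = Q′} {g′} x∉R x∈′)
    ... | refl = inChild (occupied {Q} {g} x∈) x∈ x∈′

    glued : Decomposes k P bag
    glued = record
      { vertices = covers ; edges = covers-edges ; rim = N⊆R
      ; within = bag⊆ ; small = bag-small ; connected = bag-connected }

  module _ {s : ℕ} (separable : Separable s) where

    decompose : ∀ m P → ∣ P ∣ ≤ m → ∣ N P ∣ ≤ 10 * s → ¬ ¬ ∃ (Decomposes (suc (15 * s)) P)
    decompose m P ∣P∣≤m ∣N∣≤ none with nonempty? P
    ... | no empty = none ((λ _ → Subset.⊥) , record
      { vertices  = λ x∈P → contradiction (_ , x∈P) empty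
      ; edges     = λ x∈P → contradiction (_ , x∈P) empty
      ; rim       = λ (_ , _ , x∈P , _) → contradiction (_ , x∈P) empty
      ; within    = λ _ y∈⊥ → contradiction y∈⊥ ∉⊥
      ; small     = λ _ → ≤-trans (≤-reflexive (∣⊥∣≡0 n)) z≤n
      ; connected = λ _ (_ , x∈⊥) → contradiction x∈⊥ ∉⊥ })
    decompose zero P ∣P∣≤m ∣N∣≤ none | yes (v , v∈P) = contradiction
      (≤-trans (p⊂q⇒∣p∣<∣q∣ {p = Subset.⊥} (⊆-min P , v , v∈P , ∉⊥)) ∣P∣≤m) λ ()
    decompose (suc m) P ∣P∣≤m ∣N∣≤ none | yes (v , v∈P) =
      balanced-separator separable W λ { (S , ∣S∣≤ , balanced) → split S ∣S∣≤ balanced }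
      where
      W : Subset n
      -- The vertex `v` goes into the root bag so that the components left are smaller than `P`.
      W = N P ∪ ⁅ v ⁆

      ∣W∣≤ : ∣ W ∣ ≤ suc (10 * s)
      ∣W∣≤ = ≤-trans (∣p∪q∣≤∣p∣+∣q∣ (N P) ⁅ v ⁆)
               (≤-trans (+-mono-≤ ∣N∣≤ (≤-reflexive (∣⁅x⁆∣≡1 v))) (≤-reflexive (+-comm (10 * s) 1)))

      -- The extra vertex `v` costs nothing here: half of 10s + 1 rounds down to 5s.
      half : ∀ {k} → 2 * k ≤ ∣ W ∣ → k ≤ 5 * s
      half {k} 2k≤ = ≮⇒≥ λ 5s<k → <-irrefl refl (begin-strict
        1 + 2 * (5 * s)   <⟨ n<1+n _ ⟩
        2 + 2 * (5 * s)   ≡⟨ *-suc 2 (5 * s) ⟨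
        2 * suc (5 * s)   ≤⟨ *-monoʳ-≤ 2 5s<k ⟩
        2 * k             ≤⟨ ≤-trans 2k≤ ∣W∣≤ ⟩
        1 + 10 * s        ≡⟨ cong suc (*-assoc 2 5 s) ⟩
        1 + 2 * (5 * s)   ∎)
        where open ≤-Reasoning

      module _ (S : Subset n) (∣S∣≤ : ∣ S ∣ ≤ 5 * s)
               (balanced : ∀ D → Conn D → Disjoint D S → 2 * ∣ D ∩ W ∣ ≤ ∣ W ∣) where

        R : Subset n
        -- Intersecting with `P` keeps the bag within `P` and its rim, as `within` demands.
        R = W ∪ (S ∩ P)

        ∣R∣≤ : ∣ R ∣ ≤ suc (15 * s)
        ∣R∣≤ = begin
          ∣ R ∣                  ≤⟨ ∣p∪q∣≤∣p∣+∣q∣ W (S ∩ P) ⟩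
          ∣ W ∣ + ∣ S ∩ P ∣      ≤⟨ +-mono-≤ ∣W∣≤ (≤-trans (∣p∩q∣≤∣p∣ S P) ∣S∣≤) ⟩
          suc (10 * s + 5 * s)   ≡⟨ cong suc (*-distribʳ-+ s 10 5) ⟨
          suc (15 * s)           ∎
          where open ≤-Reasoning

        N⊆R : ∀ {y} → Rim P y → y ∈ R
        N⊆R r = p⊆p∪q _ (p⊆p∪q _ (∈⟪⟫⁺ (rim? P) r))

        R⊆ : ∀ {y} → y ∈ R → y ∈ P ⊎ Rim P y
        R⊆ {y} y∈ with x∈p∪q⁻ W (S ∩ P) y∈
        ... | inj₂ y∈S∩P = inj₁ (p∩q⊆q S P y∈S∩P)
        ... | inj₁ y∈W with x∈p∪q⁻ (N P) ⁅ v ⁆ y∈W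
        ...   | inj₁ y∈N = inj₂ (∈⟪⟫⁻ (rim? P) y∈N)
        ...   | inj₂ y∈v = inj₁ (subst (_∈ P) (sym (x∈⁅y⁆⇒x≡y v y∈v)) v∈P)

        Q#S : ∀ {Q} → Q ⊆ P ─ R → Disjoint Q S
        Q#S Q⊆ x∈Q x∈S = let x∈P , x∉R = x∈p─q⁻ P R (Q⊆ x∈Q) in x∉R (q⊆p∪q W _ (x∈p∩q⁺ (x∈S , x∈P)))

        ∣Q∣≤m : ∀ {Q} → Q ⊆ P ─ R → ∣ Q ∣ ≤ m
        ∣Q∣≤m Q⊆ = s≤s⁻¹ (≤-trans (p⊂q⇒∣p∣<∣q∣ ((λ x∈Q → p─q⊆p P R (Q⊆ x∈Q)) , v , v∈P ,
          λ v∈Q → proj₂ (x∈p─q⁻ P R (Q⊆ v∈Q)) (p⊆p∪q _ (q⊆p∪q (N P) _ (x∈⁅x⁆ v))))) ∣P∣≤m)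

        -- The component together with its outer neighbours off S is connected and avoids S.
        ∣NQ∣≤ : ∀ {Q} → MaximalConn (P ─ R) Q → ∣ N Q ∣ ≤ 10 * s
        ∣NQ∣≤ {Q} max@(Q⊆ , conn , _) = decidable-stable (_ ≤? _) λ ¬small →
          grow {B = Q ∪ (N Q ─ S)} (p⊆p∪q _) conn λ { (D , Q⊆D , D-max@(D⊆ , connD , _)) → ¬small (begin
            ∣ N Q ∣                      ≡⟨ ∣p∩q∣+∣p─q∣ (N Q) S ⟨
            ∣ N Q ∩ S ∣ + ∣ N Q ─ S ∣    ≤⟨ +-mono-≤ (≤-trans (∣p∩q∣≤∣q∣ (N Q) S) ∣S∣≤) (≤-trans (p⊆q⇒∣p∣≤∣q∣ (rim⊆ Q⊆D D-max))
                                             (half (balanced D connD (λ x∈D → avoids (x∈p∪q⁻ Q _ (D⊆ x∈D)))))) ⟩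
            5 * s + 5 * s                ≡⟨ *-distribʳ-+ s 5 5 ⟨
            10 * s                       ∎) }
          where
          open ≤-Reasoning
          avoids : ∀ {x} → x ∈ Q ⊎ x ∈ N Q ─ S → x ∉ S
          avoids (inj₁ x∈Q) = Q#S Q⊆ x∈Q
          avoids (inj₂ x∈)  = proj₂ (x∈p─q⁻ (N Q) S x∈)
          rim⊆ : ∀ {D} → Q ⊆ D → MaximalConn (Q ∪ (N Q ─ S)) D → N Q ─ S ⊆ D ∩ W
          rim⊆ {D} Q⊆D D-max {y} y∈ with x∈p─q⁻ (N Q) S y∈
          ... | y∈N , y∉S with ∈⟪⟫⁻ (rim? Q) y∈N
          ...   | y∉Q , x , x∈Q , x~y = x∈p∩q⁺ (absorb D-max (Q⊆D x∈Q) x~y (q⊆p∪q Q _ y∈) , y∈W)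
            where
            y∈R⇒y∈W : y ∈ R → y ∈ W
            y∈R⇒y∈W y∈R = [ (λ y∈W → y∈W) , (λ y∈S∩P → contradiction (p∩q⊆p S P y∈S∩P) y∉S) ]′ (x∈p∪q⁻ W _ y∈R)
            y∈W : y ∈ W
            y∈W with y ∈? R | y ∈? P
            ... | yes y∈R | _       = y∈R⇒y∈W y∈R
            ... | no y∉R  | yes y∈P = contradiction (absorb max x∈Q x~y (x∈p∧x∉q⇒x∈p─q y∈P y∉R)) y∉Q
            ... | no y∉R  | no y∉P  = y∈R⇒y∈W (N⊆R (y∉P , x , p─q⊆p P R (Q⊆ x∈Q) , x~y))

        split : ⊥
        split =
          ¬¬-choice {F = λ D → D ⊆ P ─ R → Conn D → ∃[ Q ] D ⊆ Q × MaximalConn (P ─ R) Q}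
            -- Using `k` twice moves the double negation given by `grow` out past the two hypotheses
            -- on `D`.
            (λ D k → k λ D⊆ conn → ⊥-elim (grow D⊆ conn λ found → k λ _ _ → found)) λ component →
          ¬¬-choice {F = λ Q → ∃[ bag ] ((Component (P ─ R) Q × Decomposes (suc (15 * s)) Q bag) ⊎
                                         (¬ Component (P ─ R) Q × ∀ g → bag g ≡ Subset.⊥))}
            (λ Q k → ¬¬-excluded-middle {A = Component (P ─ R) Q} λ
              { (yes comp@(max , _)) → decompose m Q (∣Q∣≤m (proj₁ max)) (∣NQ∣≤ max)
                                         λ (bag , dec) → k (bag , inj₁ (comp , dec))
              ; (no ¬comp) → k ((λ _ → Subset.⊥) , inj₂ (¬comp , λ _ → refl)) }) λ children →
          none (_ , Glue.glued N⊆R R⊆ ∣R∣≤ component (proj₁ ∘ children) (proj₂ ∘ children))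

    tree-decomposition : ¬ ¬ (∃[ D ] ∀ g → ∣ TreeDecomposition.bag {Γ} D g ∣ ≤ suc (15 * s))
    tree-decomposition none =
      decompose n Subset.⊤ (∣p∣≤n Subset.⊤) (≤-trans (p⊆q⇒∣p∣≤∣q∣ N⊆⊥) (≤-trans (≤-reflexive (∣⊥∣≡0 n)) z≤n)) λ (bag , dec) →
        let open Decomposes dec in
        none (record { tree = tree ; isTree = isTree ; bag = bag ; vertices = λ _ → vertices ∈⊤
                     ; edges = edges ∈⊤ ; connected = connected } , small)
      where
      N⊆⊥ : N Subset.⊤ ⊆ Subset.⊥
      N⊆⊥ y∈ = contradiction ∈⊤ (proj₁ (∈⟪⟫⁻ (rim? Subset.⊤) y∈))

-- Simple paths in trees and the lower bound

module _ {V : Set v} (R : Rel V r) where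

  data Path : V → List V → V → Set (v ⊔ r) where
    []  : ∀ {u} → Path u [] u
    _⟨_⟩∷_ : ∀ {u v vs w} → R u v → All (u ≢_) (v ∷ vs) → Path v vs w → Path u (v ∷ vs) w

module _ {V : Set v} {R : Rel V r} where

  path-suffix : ∀ {u v vs w} → u ∈ₗ v ∷ vs → Path R v vs w → ∃[ us ] Path R u us w
  path-suffix (here refl) p           = _ , p
  path-suffix (there u∈)  (_ ⟨ _ ⟩∷ p) = path-suffix u∈ p

  -- If `u` recurs on the simple path from `v`, the part of that path from `u` on is taken. Equality
  -- of tree nodes need not be decidable, hence the double negation.
  loop-erase : ∀ {u w} → Star R u w → ¬ ¬ (∃[ vs ] Path R u vs w)
  loop-erase ε none = none ([] , [])
  loop-erase {u} (_◅_ {j = v} uRv walk) none = loop-erase walk λ (vs , p) →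
    ¬¬-excluded-middle {A = u ∈ₗ v ∷ vs} λ
      { (yes u∈) → none (path-suffix u∈ p)
      ; (no u∉)  → none (v ∷ vs , (uRv ⟨ ¬Any⇒All¬ (v ∷ vs) u∉ ⟩∷ p)) }

  path-injective : ∀ {u vs w} → Path R u vs w → ∀ {i j} → lookup (u ∷ vs) i ≡ lookup (u ∷ vs) j → i ≡ j
  path-injective p            {Fin.zero}  {Fin.zero}  eq = refl
  path-injective (_ ⟨ u∉ ⟩∷ p) {Fin.zero}  {Fin.suc j} eq = contradiction eq (All.lookup u∉ (∈-lookup j))
  path-injective (_ ⟨ u∉ ⟩∷ p) {Fin.suc i} {Fin.zero}  eq = contradiction (sym eq) (All.lookup u∉ (∈-lookup i))
  path-injective (_ ⟨ u∉ ⟩∷ p) {Fin.suc i} {Fin.suc j} eq = cong Fin.suc (path-injective p eq)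

  path-step : ∀ {u vs w} → Path R u vs w → ∀ i → R (lookup (u ∷ vs) (inject₁ i)) (lookup (u ∷ vs) (Fin.suc i))
  path-step (uRv ⟨ _ ⟩∷ p) Fin.zero    = uRv
  path-step (_ ⟨ _ ⟩∷ p)   (Fin.suc i) = path-step p i

  path-last : ∀ {u vs w} → Path R u vs w → lookup (u ∷ vs) (fromℕ (length vs)) ≡ w
  path-last []          = refl
  path-last (_ ⟨ _ ⟩∷ p) = path-last p

module Acyclic (T : Graph v e) (acyclic : ¬ Cycle T) where
  open Graph T

  NotVia : Vertex → Vertex → Rel Vertex _
  NotVia h g u w = u ~ w × ¬ (u ≡ h × w ≡ g)

  -- Loop erasure gives a simple path from `h` to `g`; without the direct step it has at least two
  -- edges, and the edge `g ~ h` closes it to a cycle.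
  no-detour : ∀ {g h} → g ~ h → ¬ Star (NotVia h g) h g
  no-detour {g} {h} g~h walk = loop-erase walk λ (vs , p) → detour vs p
    where
    detour : ∀ vs → ¬ Path (NotVia h g) h vs g
    detour []            []                 = ~-irrefl g~h
    detour (_ ∷ [])      ((_ , ¬hg) ⟨ _ ⟩∷ []) = ¬hg (refl , refl)
    detour (x ∷ y ∷ vs) p = acyclic record
      { k         = length vs
      ; at        = lookup (h ∷ x ∷ y ∷ vs)
      ; injective = path-injective p
      ; step      = proj₁ ∘ path-step p
      ; close     = subst (_~ h) (sym (path-last p)) g~h }

  Off : Vertex → Rel Vertex _
  Off g u w = u ~ w × u ≢ g × w ≢ g

  reverse-off : ∀ {g u w} → Star (Off g) u w → Star (Off g) w u
  reverse-off = reverse λ (u~w , u≢g , w≢g) → ~-sym u~w , w≢g , u≢g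

  -- Otherwise the walk from `h` to `b` off `g`, followed by that from `b` to `g` off `h`, would be
  -- a detour around the edge.
  edge-separates : ∀ {g h b} → g ~ h → Star (Off g) b h → ¬ Star (Off h) b g
  edge-separates g~h toH toG = no-detour g~h
    (Star.map (λ (u~w , _ , w≢g) → u~w , w≢g ∘ proj₂) (reverse-off toH) ◅◅
     Star.map (λ (u~w , u≢h , _) → u~w , u≢h ∘ proj₁) toG)

  path-off : ∀ {g u vs w} → All (g ≢_) (u ∷ vs) → Path _~_ u vs w → Star (Off g) u w
  path-off _ [] = ε
  path-off (g≢u ∷ g∉@(g≢v ∷ _)) (u~v ⟨ _ ⟩∷ p) = (u~v , g≢u ∘ sym , g≢v ∘ sym) ◅ path-off g∉ p

module BagCutset {Γ : FiniteGraph} (𝒟 : TreeDecomposition Γ) where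
  open FiniteGraph Γ using () renaming (order to n)
  open TreeDecomposition 𝒟 using (tree; isTree; Node; bag; vertices; edges) renaming (connected to bag-connected)
  open Graph tree
  open IsTree isTree using (node; connected; acyclic)
  open Acyclic tree acyclic
  open Connectivity Γ

  subtree-off : ∀ {x g a b} → x ∉ bag g → x ∈ bag a → x ∈ bag b → Star (Off g) a b
  subtree-off {x} {g} x∉g x∈a x∈b = gmap proj₁ (λ {u} {w} → off {u} {w}) (bag-connected x (_ , x∈a) (_ , x∈b))
    where
    off : ∀ {u w : ∃ λ g → x ∈ bag g} → proj₁ u ~ proj₁ w → Off g (proj₁ u) (proj₁ w)
    off {u , x∈u} {w , x∈w} u~w =
      u~w , (λ u≡g → x∉g (subst (λ h → x ∈ bag h) u≡g x∈u)) , (λ w≡g → x∉g (subst (λ h → x ∈ bag h) w≡g x∈w))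

  -- Adjacent vertices of `C` share a bag and the bags of one vertex form a subtree. None of these
  -- nodes is `g`, since `C` avoids its bag.
  conn-off : ∀ {C g x y a b} → Conn C → Disjoint C (bag g) → x ∈ C → y ∈ C → x ∈ bag a → y ∈ bag b → Star (Off g) a b
  conn-off {C} {g} {x} {y} conn C#g x∈C y∈C x∈a y∈b = go (conn (x , x∈C) (y , y∈C)) x∈a y∈b
    where
    go : ∀ {x y a b} → Walk C x y → proj₁ x ∈ bag a → proj₁ y ∈ bag b → Star (Off g) a b
    go {x , x∈C} ε x∈a x∈b = subtree-off (C#g x∈C) x∈a x∈b
    go {x , x∈C} (_◅_ {j = z , _} x~z walk) x∈a y∈b =
      let c , x∈c , z∈c = edges x~z
      in subtree-off (C#g x∈C) x∈a x∈c ◅◅ go walk z∈c y∈b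

  Big : Node → Subset n → Set
  Big g C = MaximalConn (∁ (bag g)) C × n < 2 * ∣ C ∣

  big-avoids : ∀ {g C} → Big g C → Disjoint C (bag g)
  big-avoids ((C⊆ , _) , _) = x∈∁p⇒x∉p ∘ C⊆

  bigs-meet : ∀ {g h C D} → Big g C → Big h D → ∃[ x ] x ∈ C × x ∈ D
  bigs-meet {C = C} {D} (_ , n<2C) (_ , n<2D) =
    let x , x∈ = intersects C D (∣p∣≤n (C ∪ D)) n<2C n<2D in x , x∈p∩q⁻ C D x∈

  -- Beyond the edge gh towards C the big component can only shrink.
  shrink : ∀ {g h C D x a} → g ~ h → Big g C → Big h D → x ∈ C → x ∈ bag a → Star (Off g) h a → D ⊆ C
  shrink {g} {h} {C} {D} g~h bigC@((C⊆ , connC , max) , _) bigD@((_ , connD , _) , _) x∈C x∈a h⇝a =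
    let z , z∈C , z∈D = bigs-meet bigC bigD
        b , z∈b = vertices z
        b⇝h = conn-off connC (big-avoids bigC) z∈C x∈C z∈b x∈a ◅◅ reverse-off h⇝a
        D#g : Disjoint D (bag g)
        D#g y∈D y∈g = edge-separates g~h b⇝h (conn-off connD (big-avoids bigD) z∈D y∈D z∈b y∈g)
    in λ y∈D → max (C ∪ D) (p⊆p∪q D) (λ w∈ → [ C⊆ , x∉p⇒x∈∁p ∘ D#g ]′ (x∈p∪q⁻ C D w∈))
                 (conn-∪ connC connD z∈C z∈D (inj₁ refl)) (q⊆p∪q C D y∈D)

  module _ (everywhere : ∀ g → ¬ ¬ ∃ (Big g)) where

    -- Induction on the size of `C`, then on the path. At the next node the big component `D` lies
    -- in `C`: if it still contains `x`, the same path is followed; if not, it is strictly smaller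
    -- and a new target is chosen in it. Arrival is absurd because `C` avoids the bag of `g`.
    chase : ∀ m {g C x a vs} → ∣ C ∣ ≤ m → Big g C → x ∈ C → x ∈ bag a → ¬ Path _~_ g vs a
    chase m ∣C∣≤m bigC x∈C x∈a [] = big-avoids bigC x∈C x∈a
    chase m {g} {C} {x} ∣C∣≤m bigC x∈C x∈a (_⟨_⟩∷_ {v = h} g~h g∉ p) = everywhere h λ (D , bigD) →
      let D⊆C = shrink g~h bigC bigD x∈C x∈a (path-off g∉ p) in next D bigD D⊆C (x ∈? D) m ∣C∣≤m
      where
      next : ∀ D → Big h D → D ⊆ C → Dec (x ∈ D) → ∀ m → ∣ C ∣ ≤ m → ⊥
      next D bigD D⊆C (yes x∈D) m ∣C∣≤m = chase m (≤-trans (p⊆q⇒∣p∣≤∣q∣ D⊆C) ∣C∣≤m) bigD x∈D x∈a p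
      next D bigD D⊆C (no x∉D) zero ∣C∣≤0 = contradiction (≤-trans (p⊂q⇒∣p∣<∣q∣ (D⊆C , x , x∈C , x∉D)) ∣C∣≤0) λ ()
      next D bigD D⊆C (no x∉D) (suc m) ∣C∣≤m =
        let z , z∈D , _ = bigs-meet bigD bigD
            b , z∈b = vertices z
        in loop-erase (connected h b) λ (_ , q) →
             chase m (s≤s⁻¹ (≤-trans (p⊂q⇒∣p∣<∣q∣ (D⊆C , x , x∈C , x∉D)) ∣C∣≤m)) bigD z∈D z∈b q

    no-bigs : ⊥
    no-bigs = everywhere node λ (C , big) →
      let z , z∈C , _ = bigs-meet big big
          b , z∈b = vertices z
      in loop-erase (connected node b) λ (_ , p) → chase n (∣p∣≤n C) big z∈C z∈b p

  some-bag-cuts : ¬ (∀ g → ¬ IsCutset Γ (bag g))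
  some-bag-cuts none = no-bigs λ g no-big → none g λ C comp → let open IsComponent comp in
    ≮⇒≥ λ n<2C → no-big (C , ((x∉p⇒x∈∁p ∘ avoids) , IsComponent.connected comp , λ E C⊆E E⊆ → maximal E C⊆E (x∈∁p⇒x∉p ∘ E⊆)) , n<2C)

-- The two inequalities

open import Data.Integer using (ℤ; +_; 1ℤ; _-_; +≤+)

m-1≤n-1 : ∀ {m n} → m ≤ n → + m - 1ℤ ℤ.≤ + n - 1ℤ
m-1≤n-1 m≤n = ℤₚ.+-monoˡ-≤ (ℤ.- 1ℤ) (+≤+ m≤n)

cut-1≤width : ∀ {Γ s k} → IsCut Γ s → (𝒟 : TreeDecomposition Γ) → IsWidth 𝒟 k → + s - 1ℤ ℤ.≤ k
cut-1≤width (_ , least) 𝒟 (_ , widest) = decidable-stable (_ ℤ.≤? _) λ ¬≤ →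
  BagCutset.some-bag-cuts 𝒟 λ g cutset → ¬≤ (ℤₚ.≤-trans (m-1≤n-1 (least (_ , cutset , refl))) (widest (g , refl)))

separable⇒tw : ∀ {Γ s t} → Separation.Separable Γ s → IsTw Γ t → t ℤ.≤ + 15 ℤ.* + s
separable⇒tw {Γ} {s} separable (_ , least) = decidable-stable (_ ℤ.≤? _) λ ¬≤ →
  Decompose.tree-decomposition Γ separable λ (𝒟 , small) →
  let open TreeDecomposition 𝒟 using (isTree; Node; bag) in
  -- The tree may be infinite, but bags have at most `order Γ` vertices, so a widest one exists.
  ¬¬-argmax {P = λ (_ : Node) → Node} (λ g → ∣ bag g ∣) (order Γ) (λ {g} _ → ∣p∣≤n (bag g))
    {IsTree.node isTree} (IsTree.node isTree) λ (g , _ , widest) →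
  ¬≤ (ℤₚ.≤-trans (least (𝒟 , (g , refl) , λ { (h , refl) → m-1≤n-1 (widest h) }))
     (ℤₚ.≤-trans (m-1≤n-1 (small g)) (ℤₚ.≤-reflexive (ℤₚ.pos-* 15 s))))

proposition1p5 : ∀ {v e} (X : Graph v e) (r : ℕ) {s : ℕ} {t : ℤ} →
    IsSep X r s → IsMaxTw X r t →
    (+ s - 1ℤ ℤ.≤ t) × (t ℤ.≤ + 15 ℤ.* + s)
proposition1p5 X r isSep@((Γ , Γ⊑X , Γ≤r , isCut) , _) ((Δ , Δ⊑X , Δ≤r , isTw) , upper) =
  -- The subgraph attaining s need not attain t; its own treewidth, which exists under double
  -- negation, lies between s - 1 and t.
  decidable-stable (_ ℤ.≤? _) (λ ¬≤ → tw-exists Γ λ { (k , isTwΓ@((𝒟 , isWidth) , _)) →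
    ¬≤ (ℤₚ.≤-trans (cut-1≤width isCut 𝒟 isWidth) (upper (Γ , Γ⊑X , Γ≤r , isTwΓ))) }) ,
  separable⇒tw (sep⇒separable isSep Δ⊑X Δ≤r) isTw
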